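{- For every $r\ge1$, let $P_r=\Phi^+(B_r)$ be the positive-root poset of type $B_r$ graded by $\operatorname{rk}(\alpha)=\operatorname{ht}(\alpha)-1$. Then $$\mathbb{H}_{P_r,\operatorname{rk}}(1,1)=\binom{2r-2}{r-1},\qquad \deg_t\mathbb{H}_{P_r,\operatorname{rk}}=r-1,$$ and the coefficient of the highest power of $t$ is $$[t^{r-1}]\,\mathbb{H}_{P_r,\operatorname{rk}}(q,t)=q^{(r-1)(r-2)}.$$ Moreover, for $0\le k\le r-1$, $$[t^k]\,\mathbb{H}_{P_r,\operatorname{rk}}(1,t)=\binom{r-1}{k}^{2}.$$
   Context: $q$-Zeta numerator: let $P$ be a finite graded poset with a unique maximum and rank function $\rho:P\to\{0,\dots,H\}$, where $H$ is the maximal rank. For $m\ge 0$ put $A_m(P,\rho;q)=\sum_{x_1\le\cdots\le x_m}q^{\rho(x_1)+\cdots+\rho(x_m)}$ (sum over weak chains in $P$; $A_0=1$). The numerator $\mathbb{H}_{P,\rho}(q,t)$ is the polynomial determined by $\sum_{m\ge 0}A_m(P,\rho;q)t^m=\mathbb{H}_{P,\rho}(q,t)/\prod_{a=0}^{H}(1-q^at)$. Type $B_r$ in $\mathbb{R}^r$ with standard basis $e_1,\dots,e_r$: simple roots $\alpha_i=e_i-e_{i+1}$ ($1\le i<r$), $\alpha_r=e_r$; positive roots $e_i-e_j$ ($i<j$), $e_i$, $e_i+e_j$ ($i<j$). Order: $\alpha\le\beta$ iff $\beta-\alpha$ is a nonnegative integer combination of simple roots. The height $\operatorname{ht}(\alpha)$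 is the sum of the simple-root coefficients of $\alpha$. -}

module Defs where

open import Algebra.Bundles.Raw using (RawRing)
import Algebra.Definitions.RawSemiring as RawSemiringDefinitions
open import Algebra.Properties.CommutativeMonoid.Sum using (sum)
open import Data.Fin.Base as Fin using (Fin; zero; suc; fromℕ; inject₁)
open import Data.Fin.Properties as Fin using (all?)
open import Data.Fin.Relation.Unary.Top using (view; ‵fromℕ; ‵inject₁)
open import Data.Integer.Base as ℤ using (ℤ; +_; 0ℤ; 1ℤ; -1ℤ)
open import Data.Integer.Properties as ℤ using (+-0-commutativeMonoid)
open import Data.Integer.Tactic.RingSolver using (solve-∀)
open import Data.List.Base
  using (List; []; _∷_; _++_; allFin; cartesianProduct; cartesianProductWith; filter; foldr; map; mapMaybe; upTo)
open import Data.List.Extrema.Nat using (max)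
open import Data.List.Membership.Propositional using (_∈_)
open import Data.List.Membership.Propositional.Properties
  using (∈-map⁺; ∈-map⁻; ∈-++⁺ˡ; ∈-++⁺ʳ; ∈-++⁻; ∈-allFin; ∈-cartesianProduct⁺)
open import Data.List.Relation.Unary.All using (All; []; _∷_)
open import Data.List.Relation.Unary.AllPairs using ([]; _∷_)
open import Data.List.Relation.Unary.Any using (here; there)
open import Data.List.Relation.Unary.Unique.Propositional using (Unique)
open import Data.List.Relation.Unary.Unique.Propositional.Properties
  using (map⁺; ++⁺; cartesianProduct⁺; allFin⁺)
open import Data.Maybe.Base using (Maybe; just; nothing)
open import Data.Nat.Base as ℕ using (ℕ; zero; suc; z≤n; s≤s)
open import Data.Nat.Properties as ℕ using ()
open import Data.Product.Base using (∃; ∃₂; _×_; _,_; proj₁; proj₂)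
open import Data.Sum.Base using (_⊎_; inj₁; inj₂)
open import Data.Vec.Base as Vec using (Vec; []; _∷_)
open import Data.Vec.Functional using (Vector; tail)
open import Data.Vec.Relation.Unary.Linked using (linked?)
open import Function.Base using (_∘_)
open import Level using (0ℓ)
open import Relation.Binary.Bundles using (DecPoset)
open import Relation.Binary.PropositionalEquality
  using (_≡_; _≢_; _≗_; refl; sym; trans; cong; cong₂; subst; isEquivalence)
open import Relation.Nullary using (¬_; Dec; yes; no; contradiction)
open import Relation.Nullary.Decidable using (map′)

module Polynomial {c ℓ} (R : RawRing c ℓ) where
  private module R = RawRing R

  -- Lists of coefficients, constant term first; trailing zeros are
  -- allowed, so polynomials are compared coefficientwise.
  Poly : Set c
  Poly = List R.Carrier

  coeff : Poly → ℕ → R.Carrier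
  coeff []      _       = R.0#
  coeff (a ∷ p) zero    = a
  coeff (a ∷ p) (suc n) = coeff p n

  constant : R.Carrier → Poly
  constant a = a ∷ []

  X : Poly
  X = R.0# ∷ R.1# ∷ []

  _+ₚ_ : Poly → Poly → Poly
  []      +ₚ s       = s
  (a ∷ p) +ₚ []      = a ∷ p
  (a ∷ p) +ₚ (b ∷ s) = (a R.+ b) ∷ (p +ₚ s)

  _*ₚ_ : Poly → Poly → Poly
  []      *ₚ s = []
  (a ∷ p) *ₚ s = map (a R.*_) s +ₚ (R.0# ∷ (p *ₚ s))

  rawRing : RawRing c ℓ
  rawRing = record
    { Carrier = Poly
    ; _≈_     = λ p s → ∀ n → coeff p n R.≈ coeff s n
    ; _+_     = _+ₚ_
    ; _*_     = _*ₚ_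
    ; -_      = map R.-_
    ; 0#      = []
    ; 1#      = constant R.1#
    }

  eval : Poly → R.Carrier → R.Carrier
  eval []      x = R.0#
  eval (a ∷ p) x = a R.+ x R.* eval p x

  HasDegree : Poly → ℕ → Set ℓ
  HasDegree p d = coeff p d R.≉ R.0# × (∀ n → d ℕ.< n → coeff p n R.≈ R.0#)

  Series : Set c
  Series = ℕ → R.Carrier

  _*ₛ_ : Series → Series → Series
  (f *ₛ g) n = foldr R._+_ R.0# (map (λ i → f i R.* g (n ℕ.∸ i)) (upTo (suc n)))

module ℤ[q]    = Polynomial ℤ.+-*-rawRing
module ℤ[t]    = Polynomial ℤ.+-*-rawRing
module ℤ[q][t] = Polynomial ℤ[q].rawRing

infixr 8 q^_
q^_ : ℕ → ℤ[q].Poly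
q^ n = ℤ[q].X ^ n
  where open RawSemiringDefinitions (RawRing.rawSemiring ℤ[q].rawRing)

q≔1 : ℤ[q][t].Poly → ℤ[t].Poly
q≔1 = map (λ p → ℤ[q].eval p 1ℤ)

record FinitePoset : Set₁ where
  field
    decPoset : DecPoset 0ℓ 0ℓ 0ℓ
  open DecPoset decPoset public using (Carrier; _≤_; _≤?_)
  field
    elements : List Carrier
    complete : ∀ x → x ∈ elements
    unique   : Unique elements

-- ρ is an arbitrary function: neither gradedness of P nor the existence
-- of a maximum enters the construction.
module Numerator (P : FinitePoset) (ρ : FinitePoset.Carrier P → ℕ) where
  open FinitePoset P
  private module Rq = RawRing ℤ[q].rawRing

  tuples : ∀ m → List (Vec Carrier m)
  tuples zero    = [] ∷ []
  tuples (suc m) = cartesianProductWith _∷_ elements (tuples m)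

  weakChains : ∀ m → List (Vec Carrier m)
  weakChains m = filter (linked? _≤?_) (tuples m)

  A : ℕ → ℤ[q].Poly
  A m = foldr Rq._+_ Rq.0# (map (λ xs → q^ Vec.sum (Vec.map ρ xs)) (weakChains m))

  maxRank : ℕ
  maxRank = max 0 (map ρ elements)

  factor : ℕ → ℤ[q][t].Poly
  factor a = 1# + (- (ℤ[q][t].constant (q^ a) * ℤ[q][t].X))
    where open RawRing ℤ[q][t].rawRing

  denominator : ℤ[q][t].Poly
  denominator = foldr _*_ 1# (map factor (upTo (suc maxRank)))
    where open RawRing ℤ[q][t].rawRing

  -- The denominator has constant term 1, so it is invertible in
  -- ℤ[q][[t]] and Σ A_m t^m = N / denominator is the same as the
  -- equation (Σ A_m t^m) · denominator = N used here.
  IsNumerator : ℤ[q][t].Poly → Set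
  IsNumerator N = ∀ k → ℤ[q][t].coeff N k Rq.≈ (A ℤ[q][t].*ₛ ℤ[q][t].coeff denominator) k

  numerator-unique : ∀ {N N′} → IsNumerator N → IsNumerator N′ →
                     RawRing._≈_ ℤ[q][t].rawRing N N′
  numerator-unique h h′ k n = trans (h k n) (sym (h′ k n))

open Numerator public using (IsNumerator)

infix 9 _⊕_ _⊖_

_⊕_ _⊖_ : ∀ {r} → Vector ℤ r → Vector ℤ r → Vector ℤ r
(v ⊕ w) k = v k ℤ.+ w k
(v ⊖ w) k = v k ℤ.- w k

e : ∀ {r} → Fin r → Vector ℤ r
e zero    zero    = 1ℤ
e zero    (suc k) = 0ℤ
e (suc i) zero    = 0ℤ
e (suc i) (suc k) = e i k

-- view i is ‵fromℕ exactly when i is the last index.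
simpleRoot : ∀ {r} → Fin r → Vector ℤ r
simpleRoot i with view i
... | ‵fromℕ {n}  = e (fromℕ n)
... | ‵inject₁ i′ = e (inject₁ i′) ⊖ e (suc i′)

data PosRoot (r : ℕ) : Set where
  minus : (i j : Fin r) → i Fin.< j → PosRoot r
  short : (i : Fin r) → PosRoot r
  plus  : (i j : Fin r) → i Fin.< j → PosRoot r

⟦_⟧ : ∀ {r} → PosRoot r → Vector ℤ r
⟦ minus i j _ ⟧ = e i ⊖ e j
⟦ short i     ⟧ = e i
⟦ plus  i j _ ⟧ = e i ⊕ e j

combination : ∀ {r} → Vector ℕ r → Vector ℤ r
combination c k = sum +-0-commutativeMonoid (λ i → + c i ℤ.* simpleRoot i k)

IsNonnegCombination : ∀ {r} → Vector ℤ r → Set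
IsNonnegCombination {r} v = ∃ λ (c : Vector ℕ r) → v ≗ combination c

_≼_ : ∀ {r} → PosRoot r → PosRoot r → Set
α ≼ β = IsNonnegCombination (⟦ β ⟧ ⊖ ⟦ α ⟧)

-- e_i is the sum of the simple roots α_k with i ≤ k.
step : ∀ {r} → Fin r → Vector ℕ r
step zero    _       = 1
step (suc i) zero    = 0
step (suc i) (suc k) = step i k

-- The coefficients of a root with respect to the simple roots; see
-- simpleCoeffs-correct and simpleCoeffs-unique below.
simpleCoeffs : ∀ {r} → PosRoot r → Vector ℕ r
simpleCoeffs (minus i j _) k = step i k ℕ.∸ step j k
simpleCoeffs (short i)     k = step i k
simpleCoeffs (plus i j _)  k = step i k ℕ.+ step j k

ht : ∀ {r} → PosRoot r → ℕ
ht α = sum ℕ.+-0-commutativeMonoid (simpleCoeffs α)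

rk : ∀ {r} → PosRoot r → ℕ
rk α = ht α ℕ.∸ 1

prev : ∀ {r} → Vector ℤ r → Vector ℤ r
prev c zero    = 0ℤ
prev c (suc k) = c (inject₁ k)

combℤ : ∀ {r} → Vector ℤ r → Vector ℤ r
combℤ c k = sum +-0-commutativeMonoid (λ i → c i ℤ.* simpleRoot i k)

sum-cong : ∀ {n} {f g : Vector ℤ n} → f ≗ g →
           sum +-0-commutativeMonoid f ≡ sum +-0-commutativeMonoid g
sum-cong {zero}  h = refl
sum-cong {suc n} h = cong₂ ℤ._+_ (h zero) (sum-cong (h ∘ suc))

sum-zero : ∀ {n} {f : Vector ℤ n} → (∀ i → f i ≡ 0ℤ) → sum +-0-commutativeMonoid f ≡ 0ℤ
sum-zero {zero}  h = refl
sum-zero {suc n} h rewrite h zero | sum-zero (h ∘ suc) = refl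

simpleRoot-suc-zero : ∀ {r} (i : Fin r) → simpleRoot (suc i) zero ≡ 0ℤ
simpleRoot-suc-zero i with view i
... | ‵fromℕ      = refl
... | ‵inject₁ i′ = refl

simpleRoot-suc-suc : ∀ {r} (i k : Fin r) → simpleRoot (suc i) (suc k) ≡ simpleRoot i k
simpleRoot-suc-suc i k with view i
... | ‵fromℕ      = refl
... | ‵inject₁ i′ = refl

combℤ-formula : ∀ {r} (c : Vector ℤ r) k → combℤ c k ≡ c k ℤ.- prev c k
combℤ-formula {suc zero} c zero = lemma (c zero)
  where
  lemma : ∀ x → x ℤ.* 1ℤ ℤ.+ 0ℤ ≡ x ℤ.- 0ℤ
  lemma = solve-∀
combℤ-formula {suc (suc r)} c zero
  rewrite sum-zero {f = λ i → c (suc i) ℤ.* simpleRoot (suc i) zero}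
            (λ i → trans (cong (c (suc i) ℤ.*_) (simpleRoot-suc-zero i)) (ℤ.*-zeroʳ (c (suc i))))
  = lemma (c zero)
  where
  lemma : ∀ x → x ℤ.* 1ℤ ℤ.+ 0ℤ ≡ x ℤ.- 0ℤ
  lemma = solve-∀
combℤ-formula {suc (suc r)} c (suc k)
  rewrite sum-cong {f = λ i → c (suc i) ℤ.* simpleRoot (suc i) (suc k)}
            (λ i → cong (c (suc i) ℤ.*_) (simpleRoot-suc-suc i k))
        | combℤ-formula (tail c) k
  = go c k
  where
  lemma₀ : ∀ x y → x ℤ.* -1ℤ ℤ.+ (y ℤ.- 0ℤ) ≡ y ℤ.- x
  lemma₀ = solve-∀
  lemma₁ : ∀ x y → x ℤ.* 0ℤ ℤ.+ y ≡ y
  lemma₁ = solve-∀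
  go : ∀ {r} (c : Vector ℤ (suc (suc r))) (k : Fin (suc r)) →
       c zero ℤ.* simpleRoot zero (suc k) ℤ.+ (c (suc k) ℤ.- prev (tail c) k) ≡ c (suc k) ℤ.- c (inject₁ k)
  go c zero    = lemma₀ (c zero) (c (suc zero))
  go c (suc k) = lemma₁ (c zero) (c (suc (suc k)) ℤ.- c (suc (inject₁ k)))

partialSum : ∀ {r} → Vector ℤ r → Vector ℤ r
partialSum v zero    = v zero
partialSum v (suc k) = v zero ℤ.+ partialSum (tail v) k

partialSum-cong : ∀ {r} {v w : Vector ℤ r} → v ≗ w → partialSum v ≗ partialSum w
partialSum-cong h zero    = h zero
partialSum-cong h (suc k) = cong₂ ℤ._+_ (h zero) (partialSum-cong (h ∘ suc) k)

prevFrom : ∀ {r} → ℤ → Vector ℤ r → Vector ℤ r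
prevFrom a c zero    = a
prevFrom a c (suc k) = c (inject₁ k)

partialSum-telescope : ∀ {r} a (v c : Vector ℤ r) → (∀ k → v k ≡ c k ℤ.- prevFrom a c k) →
                       ∀ k → partialSum v k ≡ c k ℤ.- a
partialSum-telescope a v c h zero    = h zero
partialSum-telescope a v c h (suc k)
  rewrite h zero
        | partialSum-telescope (c zero) (tail v) (tail c)
            (λ { zero → h (suc zero) ; (suc k) → h (suc (suc k)) }) k
  = lemma (c zero) a (c (suc k))
  where
  lemma : ∀ x y z → (x ℤ.- y) ℤ.+ (z ℤ.- x) ≡ z ℤ.- y
  lemma = solve-∀

partialSum-combination : ∀ {r} (c : Vector ℕ r) → partialSum (combination c) ≗ (λ k → + c k)
partialSum-combination c k = trans
  (partialSum-telescope 0ℤ (combination c) (+_ ∘ c) formula k) (ℤ.+-identityʳ (+ c k))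
  where
  formula : ∀ k → combination c k ≡ + c k ℤ.- prevFrom 0ℤ (+_ ∘ c) k
  formula zero    = combℤ-formula (+_ ∘ c) zero
  formula (suc k) = combℤ-formula (+_ ∘ c) (suc k)

combination-injective : ∀ {r} {c d : Vector ℕ r} → combination c ≗ combination d → c ≗ d
combination-injective {c = c} {d} h k = ℤ.+-injective
  (trans (sym (partialSum-combination c k))
  (trans (partialSum-cong h k) (partialSum-combination d k)))

isNonnegCombination? : ∀ {r} (v : Vector ℤ r) → Dec (IsNonnegCombination v)
isNonnegCombination? {r} v = map′ (candidate ,_) back (all? (λ k → v k ℤ.≟ combination candidate k))
  where
  candidate : Vector ℕ r
  candidate k = ℤ.∣ partialSum v k ∣

  same : ∀ c → v ≗ combination c → ∀ i → + c i ≡ + candidate i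
  same c h i = sym (cong (+_ ∘ ℤ.∣_∣) (trans (partialSum-cong h i) (partialSum-combination c i)))

  back : IsNonnegCombination v → v ≗ combination candidate
  back (c , h) k = trans (h k) (sum-cong (λ i → cong (ℤ._* simpleRoot i k) (same c h i)))

step-formula : ∀ {r} (i : Fin r) k → + step i k ℤ.- prev (+_ ∘ step i) k ≡ e i k
step-formula zero    zero          = refl
step-formula zero    (suc k)       = refl
step-formula (suc i) zero          = refl
step-formula (suc zero) (suc zero) = refl
step-formula (suc (suc i)) (suc zero) = refl
step-formula (suc i) (suc (suc k)) = step-formula i (suc k)

step-anti : ∀ {r} {i j : Fin r} → i Fin.< j → ∀ k → step j k ℕ.≤ step i k
step-anti {i = zero}  {suc j} i<j zero = z≤n
step-anti {i = zero}  {suc j} i<j (suc k) = step≤1 j k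
  where
  step≤1 : ∀ {r} (j k : Fin r) → step j k ℕ.≤ 1
  step≤1 zero    k       = s≤s z≤n
  step≤1 (suc j) zero    = z≤n
  step≤1 (suc j) (suc k) = step≤1 j k
step-anti {i = suc i} {suc j} i<j       zero    = z≤n
step-anti {i = suc i} {suc j} (s≤s i<j) (suc k) = step-anti i<j k

+∸ : ∀ {m n} → n ℕ.≤ m → + (m ℕ.∸ n) ≡ + m ℤ.- + n
+∸ {m} {n} n≤m = trans (sym (ℤ.⊖-≥ n≤m)) (sym (ℤ.m-n≡m⊖n m n))

simpleCoeffs-correct : ∀ {r} (α : PosRoot r) → ⟦ α ⟧ ≗ combination (simpleCoeffs α)
simpleCoeffs-correct α k = sym (trans (combℤ-formula (+_ ∘ simpleCoeffs α) k) (go α k))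
  where
  sub : ∀ a b c d → (a ℤ.- b) ℤ.- (c ℤ.- d) ≡ (a ℤ.- c) ℤ.- (b ℤ.- d)
  sub = solve-∀
  add : ∀ a b c d → (a ℤ.+ b) ℤ.- (c ℤ.+ d) ≡ (a ℤ.- c) ℤ.+ (b ℤ.- d)
  add = solve-∀
  go : ∀ {r} (α : PosRoot r) k →
       + simpleCoeffs α k ℤ.- prev (+_ ∘ simpleCoeffs α) k ≡ ⟦ α ⟧ k
  go (short i) k = step-formula i k
  go (minus i j i<j) k = trans (cong₂ ℤ._-_ (+∸ (step-anti i<j k)) (lower k))
    (trans (sub (+ step i k) (+ step j k) (prev (+_ ∘ step i) k) (prev (+_ ∘ step j) k)) (cong₂ ℤ._-_ (step-formula i k) (step-formula j k)))
    where
    lower : ∀ k → prev (+_ ∘ simpleCoeffs (minus i j i<j)) k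
                ≡ prev (+_ ∘ step i) k ℤ.- prev (+_ ∘ step j) k
    lower zero    = refl
    lower (suc k) = +∸ (step-anti i<j (inject₁ k))
  go (plus i j i<j) k = trans (cong (λ z → + (step i k ℕ.+ step j k) ℤ.- z) (lower k))
    (trans (add (+ step i k) (+ step j k) (prev (+_ ∘ step i) k) (prev (+_ ∘ step j) k)) (cong₂ ℤ._+_ (step-formula i k) (step-formula j k)))
    where
    lower : ∀ k → prev (+_ ∘ simpleCoeffs (plus i j i<j)) k
                ≡ prev (+_ ∘ step i) k ℤ.+ prev (+_ ∘ step j) k
    lower zero    = refl
    lower (suc k) = refl

simpleCoeffs-unique : ∀ {r} (α : PosRoot r) {c : Vector ℕ r} →
                      ⟦ α ⟧ ≗ combination c → c ≗ simpleCoeffs α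
simpleCoeffs-unique α h =
  combination-injective (λ k → trans (sym (h k)) (simpleCoeffs-correct α k))

-- The subtraction in rk never truncates.
suc-rk : ∀ {r} (α : PosRoot r) → suc (rk α) ≡ ht α
suc-rk α = ℕ.m+[n∸m]≡n (positive α)
  where
  sum≥ : ∀ {n} (c : Vector ℕ n) i → c i ℕ.≤ sum ℕ.+-0-commutativeMonoid c
  sum≥ c zero    = ℕ.m≤m+n _ _
  sum≥ c (suc i) = ℕ.≤-trans (sum≥ (tail c) i) (ℕ.m≤n+m _ _)

  step-self : ∀ {r} (i : Fin r) → step i i ≡ 1
  step-self zero    = refl
  step-self (suc i) = step-self i

  step-above : ∀ {r} {i j : Fin r} → i Fin.< j → step j i ≡ 0
  step-above {i = zero}  {suc j} i<j       = refl
  step-above {i = suc i} {suc j} (s≤s i<j) = step-above i<j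

  one : ∀ {r} (α : PosRoot r) → ∃ λ i → simpleCoeffs α i ≡ 1
  one (minus i j i<j) = i , cong₂ ℕ._∸_ (step-self i) (step-above i<j)
  one (short i)       = i , step-self i
  one (plus i j i<j)  = i , cong₂ ℕ._+_ (step-self i) (step-above i<j)

  positive : ∀ {r} (α : PosRoot r) → 1 ℕ.≤ ht α
  positive α = let i , h = one α in subst (ℕ._≤ ht α) h (sum≥ (simpleCoeffs α) i)

combination-formula : ∀ {r} (c : Vector ℕ r) k → combination c k ≡ + c k ℤ.- prev (+_ ∘ c) k
combination-formula c = combℤ-formula (+_ ∘ c)

combination-zero : ∀ {r} (k : Fin r) → combination (λ _ → 0) k ≡ 0ℤ
combination-zero k = sum-zero (λ i → ℤ.*-zeroˡ (simpleRoot i k))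

combination-+ : ∀ {r} (c d : Vector ℕ r) k →
                combination (λ i → c i ℕ.+ d i) k ≡ combination c k ℤ.+ combination d k
combination-+ c d k
  rewrite combination-formula (λ i → c i ℕ.+ d i) k
        | combination-formula c k
        | combination-formula d k
  = trans (cong (λ z → + (c k ℕ.+ d k) ℤ.- z) (lower k))
      (lemma (+ c k) (+ d k) (prev (+_ ∘ c) k) (prev (+_ ∘ d) k))
  where
  lower : ∀ k → prev (λ i → + (c i ℕ.+ d i)) k ≡ prev (+_ ∘ c) k ℤ.+ prev (+_ ∘ d) k
  lower zero    = refl
  lower (suc k) = refl
  lemma : ∀ a b x y → (a ℤ.+ b) ℤ.- (x ℤ.+ y) ≡ (a ℤ.- x) ℤ.+ (b ℤ.- y)
  lemma = solve-∀

data EntryView {r} (i k : Fin r) : ℤ → Set where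
  same      : i ≡ k → EntryView i k 1ℤ
  different : i ≢ k → EntryView i k 0ℤ

entry : ∀ {r} (i k : Fin r) → EntryView i k (e i k)
entry zero    zero    = same refl
entry zero    (suc k) = different λ ()
entry (suc i) zero    = different λ ()
entry (suc i) (suc k) with e i k | entry i k
... | _ | same refl     = same refl
... | _ | different i≢k = different (i≢k ∘ Fin.suc-injective)

e-self : ∀ {r} (i : Fin r) → e i i ≡ 1ℤ
e-self zero    = refl
e-self (suc i) = e-self i

e-other : ∀ {r} {i k : Fin r} → i ≢ k → e i k ≡ 0ℤ
e-other {i = i} {k} i≢k with e i k | entry i k
... | _ | same i≡k    = contradiction i≡k i≢k
... | _ | different _ = refl

difference-1 : ∀ {r} (k l x : Fin r) → 1ℤ ≡ e k x ℤ.- e l x → k ≡ x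
difference-1 k l x h with e k x | entry k x | e l x | entry l x
difference-1 k l x h  | _ | same k≡x    | _ | _           = k≡x
difference-1 k l x () | _ | different _ | _ | same _
difference-1 k l x () | _ | different _ | _ | different _

difference--1 : ∀ {r} (k l x : Fin r) → -1ℤ ≡ e k x ℤ.- e l x → l ≡ x
difference--1 k l x h with e k x | entry k x | e l x | entry l x
difference--1 k l x h  | _ | _           | _ | same l≡x    = l≡x
difference--1 k l x () | _ | same _      | _ | different _
difference--1 k l x () | _ | different _ | _ | different _

entry-1 : ∀ {r} (k x : Fin r) → 1ℤ ≡ e k x → k ≡ x
entry-1 k x h with e k x | entry k x
entry-1 k x h  | _ | same k≡x    = k≡x
entry-1 k x () | _ | different _

entry≢-1 : ∀ {r} (k x : Fin r) → -1ℤ ≢ e k x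
entry≢-1 k x h with e k x | entry k x
entry≢-1 k x () | _ | same _
entry≢-1 k x () | _ | different _

sum≢-1 : ∀ {r} (k l x : Fin r) → -1ℤ ≢ e k x ℤ.+ e l x
sum≢-1 k l x h with e k x | entry k x | e l x | entry l x
sum≢-1 k l x () | _ | same _      | _ | same _
sum≢-1 k l x () | _ | same _      | _ | different _
sum≢-1 k l x () | _ | different _ | _ | same _
sum≢-1 k l x () | _ | different _ | _ | different _

sum-1 : ∀ {r} (k l x : Fin r) → 1ℤ ≡ e k x ℤ.+ e l x → k ≡ x ⊎ l ≡ x
sum-1 k l x h with e k x | entry k x | e l x | entry l x
sum-1 k l x h  | _ | same k≡x    | _ | _           = inj₁ k≡x
sum-1 k l x h  | _ | different _ | _ | same l≡x    = inj₂ l≡x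
sum-1 k l x () | _ | different _ | _ | different _

module _ {r} {i j : Fin r} (i<j : i Fin.< j) where
  i≢j : i ≢ j
  i≢j i≡j = ℕ.<⇒≢ i<j (cong Fin.toℕ i≡j)

  minus-fst : ⟦ minus i j i<j ⟧ i ≡ 1ℤ
  minus-fst = cong₂ ℤ._-_ (e-self i) (e-other (i≢j ∘ sym))

  minus-snd : ⟦ minus i j i<j ⟧ j ≡ -1ℤ
  minus-snd = cong₂ ℤ._-_ (e-other i≢j) (e-self j)

  plus-fst : ⟦ plus i j i<j ⟧ i ≡ 1ℤ
  plus-fst = cong₂ ℤ._+_ (e-self i) (e-other (i≢j ∘ sym))

  plus-snd : ⟦ plus i j i<j ⟧ j ≡ 1ℤ
  plus-snd = cong₂ ℤ._+_ (e-other i≢j) (e-self j)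

minus≢short : ∀ {r} {i j k : Fin r} (i<j : i Fin.< j) → ¬ ⟦ minus i j i<j ⟧ ≗ ⟦ short k ⟧
minus≢short {j = j} {k} i<j h = entry≢-1 k j (trans (sym (minus-snd i<j)) (h j))

minus≢plus : ∀ {r} {i j k l : Fin r} (i<j : i Fin.< j) (k<l : k Fin.< l) →
             ¬ ⟦ minus i j i<j ⟧ ≗ ⟦ plus k l k<l ⟧
minus≢plus {j = j} {k} {l} i<j k<l h = sum≢-1 k l j (trans (sym (minus-snd i<j)) (h j))

plus≢short : ∀ {r} {i j k : Fin r} (i<j : i Fin.< j) → ¬ ⟦ plus i j i<j ⟧ ≗ ⟦ short k ⟧
plus≢short {i = i} {j} {k} i<j h = i≢j i<j
  (trans (sym (entry-1 k i (trans (sym (plus-fst i<j)) (h i))))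
         (entry-1 k j (trans (sym (plus-snd i<j)) (h j))))

⟦⟧-injective : ∀ {r} (α β : PosRoot r) → ⟦ α ⟧ ≗ ⟦ β ⟧ → α ≡ β
⟦⟧-injective (minus i j p) (minus k l q) h
  with refl ← difference-1 k l i (trans (sym (minus-fst p)) (h i))
     | refl ← difference--1 k l j (trans (sym (minus-snd p)) (h j))
  = cong (minus i j) (ℕ.<-irrelevant p q)
⟦⟧-injective (minus i j p) (short k)     h = contradiction h (minus≢short {k = k} p)
⟦⟧-injective (minus i j p) (plus k l q)  h = contradiction h (minus≢plus p q)
⟦⟧-injective (short i)     (minus k l q) h = contradiction (sym ∘ h) (minus≢short {k = i} q)
⟦⟧-injective (short i)     (short k)     h =
  cong short (sym (entry-1 k i (trans (sym (e-self i)) (h i))))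
⟦⟧-injective (short i)     (plus k l q)  h = contradiction (sym ∘ h) (plus≢short {k = i} q)
⟦⟧-injective (plus i j p)  (minus k l q) h = contradiction (sym ∘ h) (minus≢plus q p)
⟦⟧-injective (plus i j p)  (short k)     h = contradiction h (plus≢short {k = k} p)
⟦⟧-injective (plus i j p)  (plus k l q)  h
  with sum-1 k l i (trans (sym (plus-fst p)) (h i)) | sum-1 k l j (trans (sym (plus-snd p)) (h j))
... | inj₁ refl | inj₂ refl = cong (plus i j) (ℕ.<-irrelevant p q)
... | inj₁ refl | inj₁ k≡j  = contradiction k≡j (i≢j p)
... | inj₂ refl | inj₂ l≡j  = contradiction l≡j (i≢j p)
... | inj₂ refl | inj₁ refl = contradiction p (ℕ.<-asym q)

≼-refl : ∀ {r} {α : PosRoot r} → α ≼ α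
≼-refl {α = α} = (λ _ → 0) , λ k → trans (ℤ.+-inverseʳ (⟦ α ⟧ k)) (sym (combination-zero k))

≼-trans : ∀ {r} {α β γ : PosRoot r} → α ≼ β → β ≼ γ → α ≼ γ
≼-trans {α = α} {β} {γ} (c , h) (d , h′) = (λ i → c i ℕ.+ d i) , λ k →
  trans (lemma (⟦ α ⟧ k) (⟦ β ⟧ k) (⟦ γ ⟧ k))
  (trans (cong₂ ℤ._+_ (h k) (h′ k)) (sym (combination-+ c d k)))
  where
  lemma : ∀ a b c → c ℤ.- a ≡ (b ℤ.- a) ℤ.+ (c ℤ.- b)
  lemma = solve-∀

≼-antisym : ∀ {r} {α β : PosRoot r} → α ≼ β → β ≼ α → α ≡ β
≼-antisym {r} {α} {β} (c , h) (d , h′) =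
  ⟦⟧-injective α β (λ k → sym (ℤ.i-j≡0⇒i≡j (⟦ β ⟧ k) (⟦ α ⟧ k) (difference k)))
  where
  lemma : ∀ a b → (b ℤ.- a) ℤ.+ (a ℤ.- b) ≡ 0ℤ
  lemma = solve-∀
  c+d≡0 : ∀ i → c i ℕ.+ d i ≡ 0
  c+d≡0 = combination-injective (λ k →
    trans (combination-+ c d k)
    (trans (sym (cong₂ ℤ._+_ (h k) (h′ k)))
    (trans (lemma (⟦ α ⟧ k) (⟦ β ⟧ k)) (sym (combination-zero k)))))
  difference : ∀ k → ⟦ β ⟧ k ℤ.- ⟦ α ⟧ k ≡ 0ℤ
  difference k = trans (h k) (sum-zero (λ i →
    cong (λ n → + n ℤ.* simpleRoot i k) (ℕ.m+n≡0⇒m≡0 (c i) (c+d≡0 i))))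

_≟ᵣ_ : ∀ {r} (α β : PosRoot r) → Dec (α ≡ β)
α ≟ᵣ β = map′ (⟦⟧-injective α β) (λ { refl k → refl }) (all? (λ k → ⟦ α ⟧ k ℤ.≟ ⟦ β ⟧ k))

_≼?_ : ∀ {r} (α β : PosRoot r) → Dec (α ≼ β)
α ≼? β = isNonnegCombination? (⟦ β ⟧ ⊖ ⟦ α ⟧)

rootDecPoset : ℕ → DecPoset 0ℓ 0ℓ 0ℓ
rootDecPoset r = record
  { Carrier           = PosRoot r
  ; _≈_               = _≡_
  ; _≤_               = _≼_
  ; isDecPartialOrder = record
    { isPartialOrder = record
      { isPreorder = record
        { isEquivalence = isEquivalence
        ; reflexive     = λ { {α} refl → ≼-refl {α = α} }
        ; trans         = λ {α β γ} → ≼-trans {α = α} {β} {γ}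
        }
      ; antisym = ≼-antisym
      }
    ; _≟_  = _≟ᵣ_
    ; _≤?_ = _≼?_
    }
  }

OrderedPair : ℕ → Set
OrderedPair r = ∃₂ λ (i j : Fin r) → i Fin.< j

orderedPairs : ∀ r → List (OrderedPair r)
orderedPairs r = mapMaybe check (cartesianProduct (allFin r) (allFin r))
  module OrderedPairs where
  check : Fin r × Fin r → Maybe (OrderedPair r)
  check (i , j) with i Fin.<? j
  ... | yes i<j = just (i , j , i<j)
  ... | no  _   = nothing

minusRoot plusRoot : ∀ {r} → OrderedPair r → PosRoot r
minusRoot (i , j , i<j) = minus i j i<j
plusRoot  (i , j , i<j) = plus i j i<j

posRoots : ∀ r → List (PosRoot r)
posRoots r = map minusRoot (orderedPairs r)
          ++ map short (allFin r)
          ++ map plusRoot (orderedPairs r)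

module _ {A B : Set} (f : A → Maybe B) where
  mapMaybe-∈ : ∀ {x y xs} → f x ≡ just y → x ∈ xs → y ∈ mapMaybe f xs
  mapMaybe-∈ {xs = x ∷ xs} fx≡y (here refl) rewrite fx≡y = here refl
  mapMaybe-∈ {xs = x ∷ xs} fx≡y (there x∈) with f x
  ... | just _  = there (mapMaybe-∈ fx≡y x∈)
  ... | nothing = mapMaybe-∈ fx≡y x∈

  mapMaybe-unique : (∀ {x y z} → f x ≡ just z → f y ≡ just z → x ≡ y) →
                    ∀ {xs} → Unique xs → Unique (mapMaybe f xs)
  mapMaybe-unique inj [] = []
  mapMaybe-unique inj {x ∷ xs} (x∉xs ∷ u) with f x in fx
  ... | nothing = mapMaybe-unique inj u
  ... | just z  = avoid x∉xs ∷ mapMaybe-unique inj u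
    where
    avoid : ∀ {ys} → All (x ≢_) ys → All (z ≢_) (mapMaybe f ys)
    avoid [] = []
    avoid {y ∷ ys} (x≢y ∷ a) with f y in fy
    ... | nothing = avoid a
    ... | just w  = (λ { refl → x≢y (inj fx fy) }) ∷ avoid a

module _ {r : ℕ} where
  open OrderedPairs r

  check-just : ∀ {i j} (i<j : i Fin.< j) → check (i , j) ≡ just (i , j , i<j)
  check-just {i} {j} i<j with i Fin.<? j
  ... | yes p  = cong (λ q → just (i , j , q)) (ℕ.<-irrelevant p i<j)
  ... | no i≮j = contradiction i<j i≮j

  check-fst : ∀ x {z} → check x ≡ just z → x ≡ (proj₁ z , proj₁ (proj₂ z))
  check-fst (i , j) h with i Fin.<? j
  check-fst (i , j) refl | yes _ = refl

  orderedPairs-complete : ∀ {i j} (i<j : i Fin.< j) → (i , j , i<j) ∈ orderedPairs r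
  orderedPairs-complete i<j =
    mapMaybe-∈ check (check-just i<j) (∈-cartesianProduct⁺ (∈-allFin _) (∈-allFin _))

  orderedPairs-unique : Unique (orderedPairs r)
  orderedPairs-unique = mapMaybe-unique check
    (λ {x} {y} hx hy → trans (check-fst x hx) (sym (check-fst y hy)))
    (cartesianProduct⁺ (allFin⁺ r) (allFin⁺ r))

posRoots-complete : ∀ {r} (α : PosRoot r) → α ∈ posRoots r
posRoots-complete (minus i j i<j) = ∈-++⁺ˡ (∈-map⁺ minusRoot (orderedPairs-complete i<j))
posRoots-complete (short i)       = ∈-++⁺ʳ (map minusRoot (orderedPairs _)) (∈-++⁺ˡ (∈-map⁺ short (∈-allFin i)))
posRoots-complete {r} (plus i j i<j) =
  ∈-++⁺ʳ (map minusRoot (orderedPairs _)) (∈-++⁺ʳ (map short (allFin r)) (∈-map⁺ plusRoot (orderedPairs-complete i<j)))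

posRoots-unique : ∀ r → Unique (posRoots r)
posRoots-unique r =
  ++⁺ (map⁺ (λ { refl → refl }) orderedPairs-unique)
      (++⁺ (map⁺ (λ { refl → refl }) (allFin⁺ r))
           (map⁺ (λ { refl → refl }) orderedPairs-unique)
           short-plus)
      minus-rest
  where
  short-plus : ∀ {α} → ¬ (α ∈ map short (allFin r) × α ∈ map plusRoot (orderedPairs r))
  short-plus (p , q) with ∈-map⁻ _ p | ∈-map⁻ _ q
  ... | _ , _ , refl | _ , _ , ()

  minus-rest : ∀ {α} → ¬ (α ∈ map minusRoot (orderedPairs r)
                        × α ∈ map short (allFin r) ++ map plusRoot (orderedPairs r))
  minus-rest (p , q) with ∈-map⁻ _ p | ∈-++⁻ (map short (allFin r)) q
  ... | _ , _ , refl | inj₁ q′ with _ , _ , () ← ∈-map⁻ _ q′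
  ... | _ , _ , refl | inj₂ q′ with _ , _ , () ← ∈-map⁻ _ q′

Φ⁺B : ℕ → FinitePoset
Φ⁺B r = record
  { decPoset = rootDecPoset r
  ; elements = posRoots r
  ; complete = posRoots-complete
  ; unique   = posRoots-unique r
  }

{-# OPTIONS --safe #-}

-- The root with coordinates (i , c), where i ≤ c and i + c ≤ 2m = 2r - 2, has
-- rank 2m - i - c, and roots are ordered componentwise downwards. Let Y(i , c)
-- be the generating series of the weak chains in the up-set of (i , c).
-- Inclusion-exclusion gives
--   (1 - q^ρ t) Y(i , c) = Y(i - 1 , c) + Y(i , c - 1) - Y(i - 1 , c - 1),
-- which, after clearing denominators, is the recurrence
--   M(i , c) = M(i - 1 , c) + M(i , c - 1) - (1 - q^(ρ + 1) t) M(i - 1 , c - 1)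
-- with M(0 , c) = 1 and M(i , i) = M(i - 1 , i). Adjoining the minimal roots one
-- after the other, N(j) = numerator of the roots with first coordinate ≤ j obeys
--   N(j) = N(j - 1) + M(j , 2m - j) - (1 - t) M(j - 1 , 2m - j),
-- and N(m) is the numerator sought. The recurrences yield the degree and the
-- leading coefficient, and at q = 1 they are solved by
--   [t^k] M(i , c) = C(i , k) C(c , k) - C(i + 1 , k + 1) C(c - 1 , k - 1),
--   [t^k] N(j)     = C(j , k) C(2m - j , k).

module Submission where

open import Defs
open import Algebra.Bundles using (CommutativeRing; Semiring)
open import Algebra.Bundles.Raw using (RawRing)
open import Algebra.Morphism.Structures using (module SemiringMorphisms)
open import Algebra.Properties.CommutativeMonoid.Sum using (sum; ∑-distrib-+; sum-cong-≗)
import Algebra.Properties.Semiring.Exp as Exp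
open import Data.Bool.Base using (if_then_else_)
open import Data.Fin.Base as Fin using (Fin; zero; suc; fromℕ; fromℕ<; inject₁; toℕ)
open import Data.Fin.Properties as Fin using (toℕ-fromℕ<; toℕ-inject₁; toℕ≤pred[n]; toℕ<n)
open import Data.Integer.Base as ℤ using (ℤ; +_; 0ℤ; 1ℤ)
open import Data.Integer.Properties as ℤ using ()
import Data.Integer.Tactic.RingSolver as ℤ-Solver
open import Data.List.Base using (List; []; _∷_; _++_; applyUpTo; cartesianProductWith; filter; foldr; map; upTo)
open import Data.List.Extrema.Nat using (max≤v⁺; xs≤max)
open import Data.List.Membership.Propositional using (_∈_)
open import Data.List.Membership.Propositional.Properties using (∈-map⁺)
open import Data.List.Properties using (applyUpTo-∷ʳ; upTo-∷ʳ)
open import Data.List.Relation.Unary.All as All using (All; []; _∷_)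
import Data.List.Relation.Unary.All.Properties as All
open import Data.List.Relation.Unary.AllPairs using ([]; _∷_)
open import Data.List.Relation.Unary.Any using (here; there)
open import Data.List.Relation.Unary.Unique.Propositional using (Unique)
open import Data.Nat.Base as ℕ using (ℕ; zero; suc; z≤n; s≤s; s≤s⁻¹; _∸_)
open import Data.Nat.Combinatorics using (_C_; nCn≡1; nCk≡nC[n∸k]; k>n⇒nCk≡0; nCk+nC[k+1]≡[n+1]C[k+1])
open import Data.Nat.ListAction using () renaming (sum to sumℕ)
open import Data.Nat.ListAction.Properties using () renaming (sum-++ to sumℕ-++)
open import Data.Nat.Properties as ℕ using (_<?_; _≟_; m≤m+n; m≤n+m; ≤-trans; ≤-refl; ≤-reflexive)
import Data.Nat.Tactic.RingSolver as ℕ-Solver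
open import Data.Product.Base using (∃; Σ-syntax; _×_; _,_; proj₁; proj₂)
open import Data.Sum.Base using (inj₁; inj₂)
open import Data.Unit.Base using (tt)
open import Data.Vec.Base as Vec using (Vec; []; _∷_)
open import Data.Vec.Relation.Unary.Linked using (linked?; _∷_)
open import Function.Base using (_∘_; id)
open import Relation.Binary.Bundles using (Setoid)
open import Relation.Binary.Definitions using (tri<; tri≈; tri>)
open import Relation.Binary.PropositionalEquality as ≡ using (_≡_; _≢_)
import Relation.Binary.Reasoning.Setoid as SetoidReasoning
open import Relation.Nullary using (¬_; Dec; does; yes; no; contradiction)
open import Relation.Nullary.Decidable using (_×-dec_)

-- Polynomials over a commutative ring

-- With indices from 0 to m, row i of the coordinates lists the roots e_i + e_(i+1), ..., e_i + e_m,
-- e_i, e_i - e_m, ..., e_i - e_(i+1), each one simple root below its predecessor, while c runs from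
-- i to 2m - i. The closed forms come from lattice paths. Take the paths from (0 , 0) to (i , c)
-- inside i ≤ c and give each corner, where an i-step is followed by a c-step, the weight q^rank t.
-- Paths with a corner at (i , c - 1), a point of rank ρ + 1, extend paths to (i - 1 , c - 1);
-- adding M(i - 1 , c) and M(i , c - 1) counts them without that corner, and the term -(1 - q^(ρ +
-- 1) t) M(i - 1 , c - 1) inserts its weight. In the same way N(j) sums over the paths of 2m + 1
-- steps that end with a c-step and have at most j i-steps. Hence the degree in t is m; the leading
-- term comes from the staircase path alone, with corners (1 , 1), ..., (m , m); and q = t = 1
-- counts all paths of 2m steps inside i ≤ c.

module PolynomialRing {c ℓ} (R : CommutativeRing c ℓ) where
  open CommutativeRing R hiding (rawRing)
  open import Algebra.Properties.Ring ring using (-0#≈0#)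
  open import Algebra.Properties.CommutativeSemigroup +-commutativeSemigroup using (interchange; x∙yz≈y∙xz)
  open import Algebra.Properties.CommutativeSemigroup *-commutativeSemigroup using () renaming (x∙yz≈y∙xz to x*yz≈y*xz)
  open Polynomial (CommutativeRing.rawRing R)
  open RawRing rawRing using () renaming (1# to 1ₚ; -_ to -ₚ_)

  infix 4 _≋_

  -- The coefficientwise equality of rawRing, as a record so that both sides
  -- can be inferred from it.
  record _≋_ (p s : Poly) : Set ℓ where
    constructor coeffwise
    field
      at : ∀ n → coeff p n ≈ coeff s n
  open _≋_ public

  coeff-+ : ∀ p s n → coeff (p +ₚ s) n ≈ coeff p n + coeff s n
  coeff-+ []      s       n       = sym (+-identityˡ _)
  coeff-+ (a ∷ p) []      n       = sym (+-identityʳ _)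
  coeff-+ (a ∷ p) (b ∷ s) zero    = refl
  coeff-+ (a ∷ p) (b ∷ s) (suc n) = coeff-+ p s n

  coeff-map : ∀ {f : Carrier → Carrier} → f 0# ≈ 0# → ∀ p n → coeff (map f p) n ≈ f (coeff p n)
  coeff-map f0 []      n       = sym f0
  coeff-map f0 (a ∷ p) zero    = refl
  coeff-map f0 (a ∷ p) (suc n) = coeff-map f0 p n

  coeff-scale : ∀ a p n → coeff (map (a *_) p) n ≈ a * coeff p n
  coeff-scale a = coeff-map (zeroʳ a)

  coeff-∷*-zero : ∀ a p s → coeff ((a ∷ p) *ₚ s) 0 ≈ a * coeff s 0
  coeff-∷*-zero a p s = trans (coeff-+ (map (a *_) s) (0# ∷ (p *ₚ s)) 0)
    (trans (+-identityʳ _) (coeff-scale a s 0))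

  coeff-∷*-suc : ∀ a p s n → coeff ((a ∷ p) *ₚ s) (suc n) ≈ a * coeff s (suc n) + coeff (p *ₚ s) n
  coeff-∷*-suc a p s n = trans (coeff-+ (map (a *_) s) (0# ∷ (p *ₚ s)) (suc n))
    (+-congʳ (coeff-scale a s (suc n)))

  *ₚ-congˡ : ∀ p {s u} → s ≋ u → p *ₚ s ≋ p *ₚ u
  *ₚ-congˡ []      h .at n       = refl
  *ₚ-congˡ (a ∷ p) {s} {u} h .at zero    =
    trans (coeff-∷*-zero a p s) (trans (*-congˡ (h .at 0)) (sym (coeff-∷*-zero a p u)))
  *ₚ-congˡ (a ∷ p) {s} {u} h .at (suc n) =
    trans (coeff-∷*-suc a p s n)
    (trans (+-cong (*-congˡ (h .at (suc n))) (*ₚ-congˡ p h .at n)) (sym (coeff-∷*-suc a p u n)))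

  *ₚ-zeroʳ : ∀ p → p *ₚ [] ≋ []
  *ₚ-zeroʳ [] .at n       = refl
  *ₚ-zeroʳ (a ∷ p) .at zero    = refl
  *ₚ-zeroʳ (a ∷ p) .at (suc n) = *ₚ-zeroʳ p .at n

  -- `_*ₚ_` recurses on its left factor. This and `coeff-*∷-suc` are the mirror rules for the right
  -- factor; comparing the two pairs of rules gives commutativity.
  coeff-*∷-zero : ∀ p b s → coeff (p *ₚ (b ∷ s)) 0 ≈ b * coeff p 0
  coeff-*∷-zero []      b s = sym (zeroʳ b)
  coeff-*∷-zero (a ∷ p) b s = trans (+-identityʳ _) (*-comm a b)

  coeff-*∷-suc : ∀ p b s n → coeff (p *ₚ (b ∷ s)) (suc n) ≈ b * coeff p (suc n) + coeff (p *ₚ s) n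
  coeff-*∷-suc []      b s n    = sym (trans (+-identityʳ _) (zeroʳ b))
  coeff-*∷-suc (a ∷ p) b s zero = begin
    coeff ((a ∷ p) *ₚ (b ∷ s)) 1              ≈⟨ coeff-∷*-suc a p (b ∷ s) 0 ⟩
    a * coeff s 0 + coeff (p *ₚ (b ∷ s)) 0    ≈⟨ +-comm _ _ ⟩
    coeff (p *ₚ (b ∷ s)) 0 + a * coeff s 0    ≈⟨ +-cong (coeff-*∷-zero p b s) (sym (coeff-∷*-zero a p s)) ⟩
    b * coeff p 0 + coeff ((a ∷ p) *ₚ s) 0 ∎
    where open SetoidReasoning setoid
  coeff-*∷-suc (a ∷ p) b s (suc n) = begin
    coeff ((a ∷ p) *ₚ (b ∷ s)) (suc (suc n))                                 ≈⟨ coeff-∷*-suc a p (b ∷ s) (suc n) ⟩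
    a * coeff s (suc n) + coeff (p *ₚ (b ∷ s)) (suc n)                       ≈⟨ +-congˡ (coeff-*∷-suc p b s n) ⟩
    a * coeff s (suc n) + (b * coeff p (suc n) + coeff (p *ₚ s) n)           ≈⟨ x∙yz≈y∙xz _ _ _ ⟩
    b * coeff p (suc n) + (a * coeff s (suc n) + coeff (p *ₚ s) n)           ≈⟨ +-congˡ (coeff-∷*-suc a p s n) ⟨
    b * coeff p (suc n) + coeff ((a ∷ p) *ₚ s) (suc n) ∎
    where open SetoidReasoning setoid

  *ₚ-comm : ∀ p s → p *ₚ s ≋ s *ₚ p
  *ₚ-comm []      s .at n       = sym (*ₚ-zeroʳ s .at n)
  *ₚ-comm (a ∷ p) s .at zero    = trans (coeff-∷*-zero a p s) (sym (coeff-*∷-zero s a p))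
  *ₚ-comm (a ∷ p) s .at (suc n) = begin
    coeff ((a ∷ p) *ₚ s) (suc n)              ≈⟨ coeff-∷*-suc a p s n ⟩
    a * coeff s (suc n) + coeff (p *ₚ s) n    ≈⟨ +-congˡ (*ₚ-comm p s .at n) ⟩
    a * coeff s (suc n) + coeff (s *ₚ p) n    ≈⟨ coeff-*∷-suc s a p n ⟨
    coeff (s *ₚ (a ∷ p)) (suc n) ∎
    where open SetoidReasoning setoid

  *ₚ-distribˡ : ∀ p s u → p *ₚ (s +ₚ u) ≋ (p *ₚ s) +ₚ (p *ₚ u)
  *ₚ-distribˡ []      s u .at n       = refl
  *ₚ-distribˡ (a ∷ p) s u .at zero    = begin
    coeff ((a ∷ p) *ₚ (s +ₚ u)) 0                          ≈⟨ coeff-∷*-zero a p (s +ₚ u) ⟩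
    a * coeff (s +ₚ u) 0                                   ≈⟨ *-congˡ (coeff-+ s u 0) ⟩
    a * (coeff s 0 + coeff u 0)                            ≈⟨ distribˡ a _ _ ⟩
    a * coeff s 0 + a * coeff u 0                          ≈⟨ +-cong (coeff-∷*-zero a p s) (coeff-∷*-zero a p u) ⟨
    coeff ((a ∷ p) *ₚ s) 0 + coeff ((a ∷ p) *ₚ u) 0        ≈⟨ coeff-+ ((a ∷ p) *ₚ s) ((a ∷ p) *ₚ u) 0 ⟨
    coeff (((a ∷ p) *ₚ s) +ₚ ((a ∷ p) *ₚ u)) 0 ∎
    where open SetoidReasoning setoid
  *ₚ-distribˡ (a ∷ p) s u .at (suc n) = begin
    coeff ((a ∷ p) *ₚ (s +ₚ u)) (suc n)
      ≈⟨ coeff-∷*-suc a p (s +ₚ u) n ⟩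
    a * coeff (s +ₚ u) (suc n) + coeff (p *ₚ (s +ₚ u)) n
      ≈⟨ +-cong (trans (*-congˡ (coeff-+ s u (suc n))) (distribˡ a _ _))
                (trans (*ₚ-distribˡ p s u .at n) (coeff-+ (p *ₚ s) (p *ₚ u) n)) ⟩
    (a * coeff s (suc n) + a * coeff u (suc n)) + (coeff (p *ₚ s) n + coeff (p *ₚ u) n)
      ≈⟨ interchange _ _ _ _ ⟩
    (a * coeff s (suc n) + coeff (p *ₚ s) n) + (a * coeff u (suc n) + coeff (p *ₚ u) n)
      ≈⟨ +-cong (coeff-∷*-suc a p s n) (coeff-∷*-suc a p u n) ⟨
    coeff ((a ∷ p) *ₚ s) (suc n) + coeff ((a ∷ p) *ₚ u) (suc n)
      ≈⟨ coeff-+ ((a ∷ p) *ₚ s) ((a ∷ p) *ₚ u) (suc n) ⟨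
    coeff (((a ∷ p) *ₚ s) +ₚ ((a ∷ p) *ₚ u)) (suc n) ∎
    where open SetoidReasoning setoid

  polySetoid : Setoid c ℓ
  polySetoid = record
    { Carrier       = Poly
    ; _≈_           = _≋_
    ; isEquivalence = record
      { refl  = coeffwise λ n → refl
      ; sym   = λ h → coeffwise λ n → sym (h .at n)
      ; trans = λ h h′ → coeffwise λ n → trans (h .at n) (h′ .at n)
      }
    }

  module ≋ = Setoid polySetoid

  +ₚ-cong : ∀ {p p′ s s′} → p ≋ p′ → s ≋ s′ → p +ₚ s ≋ p′ +ₚ s′
  +ₚ-cong {p} {p′} {s} {s′} h h′ .at n =
    trans (coeff-+ p s n) (trans (+-cong (h .at n) (h′ .at n)) (sym (coeff-+ p′ s′ n)))

  *ₚ-cong : ∀ {p p′ s s′} → p ≋ p′ → s ≋ s′ → p *ₚ s ≋ p′ *ₚ s′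
  *ₚ-cong {p} {p′} {s} {s′} h h′ =
    ≋.trans (*ₚ-congˡ p h′) (≋.trans (*ₚ-comm p s′) (≋.trans (*ₚ-congˡ s′ h) (*ₚ-comm s′ p′)))

  *ₚ-distribʳ : ∀ u p s → (p +ₚ s) *ₚ u ≋ (p *ₚ u) +ₚ (s *ₚ u)
  *ₚ-distribʳ u p s = ≋.trans (*ₚ-comm (p +ₚ s) u)
    (≋.trans (*ₚ-distribˡ u p s) (+ₚ-cong (*ₚ-comm u p) (*ₚ-comm u s)))

  scale-*ₚ : ∀ a p s → map (a *_) p *ₚ s ≋ map (a *_) (p *ₚ s)
  scale-*ₚ a []      s .at n       = refl
  scale-*ₚ a (b ∷ p) s .at zero    = begin
    coeff ((a * b ∷ map (a *_) p) *ₚ s) 0    ≈⟨ coeff-∷*-zero (a * b) (map (a *_) p) s ⟩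
    (a * b) * coeff s 0                      ≈⟨ *-assoc a b _ ⟩
    a * (b * coeff s 0)                      ≈⟨ *-congˡ (coeff-∷*-zero b p s) ⟨
    a * coeff ((b ∷ p) *ₚ s) 0               ≈⟨ coeff-scale a ((b ∷ p) *ₚ s) 0 ⟨
    coeff (map (a *_) ((b ∷ p) *ₚ s)) 0 ∎
    where open SetoidReasoning setoid
  scale-*ₚ a (b ∷ p) s .at (suc n) = begin
    coeff ((a * b ∷ map (a *_) p) *ₚ s) (suc n)
      ≈⟨ coeff-∷*-suc (a * b) (map (a *_) p) s n ⟩
    (a * b) * coeff s (suc n) + coeff (map (a *_) p *ₚ s) n
      ≈⟨ +-cong (*-assoc a b _) (trans (scale-*ₚ a p s .at n) (coeff-scale a (p *ₚ s) n)) ⟩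
    a * (b * coeff s (suc n)) + a * coeff (p *ₚ s) n
      ≈⟨ distribˡ a _ _ ⟨
    a * (b * coeff s (suc n) + coeff (p *ₚ s) n)
      ≈⟨ *-congˡ (coeff-∷*-suc b p s n) ⟨
    a * coeff ((b ∷ p) *ₚ s) (suc n)
      ≈⟨ coeff-scale a ((b ∷ p) *ₚ s) (suc n) ⟨
    coeff (map (a *_) ((b ∷ p) *ₚ s)) (suc n) ∎
    where open SetoidReasoning setoid

  shift-*ₚ : ∀ p s → (0# ∷ p) *ₚ s ≋ 0# ∷ (p *ₚ s)
  shift-*ₚ p s .at zero    = trans (coeff-∷*-zero 0# p s) (zeroˡ _)
  shift-*ₚ p s .at (suc n) = trans (coeff-∷*-suc 0# p s n) (trans (+-congʳ (zeroˡ _)) (+-identityˡ _))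

  shift-cong : ∀ {p s} → p ≋ s → 0# ∷ p ≋ 0# ∷ s
  shift-cong h .at zero    = refl
  shift-cong h .at (suc n) = h .at n

  *ₚ-assoc : ∀ p s u → (p *ₚ s) *ₚ u ≋ p *ₚ (s *ₚ u)
  *ₚ-assoc []      s u = ≋.refl
  *ₚ-assoc (a ∷ p) s u = begin
    (map (a *_) s +ₚ (0# ∷ (p *ₚ s))) *ₚ u              ≈⟨ *ₚ-distribʳ u (map (a *_) s) (0# ∷ (p *ₚ s)) ⟩
    (map (a *_) s *ₚ u) +ₚ ((0# ∷ (p *ₚ s)) *ₚ u)       ≈⟨ +ₚ-cong (scale-*ₚ a s u) (shift-*ₚ (p *ₚ s) u) ⟩
    map (a *_) (s *ₚ u) +ₚ (0# ∷ ((p *ₚ s) *ₚ u))       ≈⟨ +ₚ-cong {map (a *_) (s *ₚ u)} ≋.refl (shift-cong (*ₚ-assoc p s u)) ⟩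
    map (a *_) (s *ₚ u) +ₚ (0# ∷ (p *ₚ (s *ₚ u))) ∎
    where open SetoidReasoning polySetoid

  *ₚ-identityˡ : ∀ p → 1ₚ *ₚ p ≋ p
  *ₚ-identityˡ p .at zero    = trans (coeff-∷*-zero 1# [] p) (*-identityˡ _)
  *ₚ-identityˡ p .at (suc n) = trans (coeff-∷*-suc 1# [] p n) (trans (+-identityʳ _) (*-identityˡ _))

  commutativeRing : CommutativeRing c ℓ
  commutativeRing = record
    { Carrier           = Poly
    ; _≈_               = RawRing._≈_ rawRing
    ; _+_               = _+ₚ_
    ; _*_               = _*ₚ_
    ; -_                = -ₚ_
    ; 0#                = []
    ; 1#                = 1ₚ
    ; isCommutativeRing = record
      { isRing = record
        { +-isAbelianGroup = record
          { isGroup = record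
            { isMonoid = record
              { isSemigroup = record
                { isMagma = record
                  { isEquivalence = record
                    { refl  = λ n → refl
                    ; sym   = λ h n → sym (h n)
                    ; trans = λ h h′ n → trans (h n) (h′ n)
                    }
                  ; ∙-cong = λ {p} {p′} {s} {s′} h h′ → +ₚ-cong {p} {p′} {s} {s′} (coeffwise h) (coeffwise h′) .at
                  }
                ; assoc   = λ p s u → +ₚ-assoc p s u .at
                }
              ; identity = (λ p n → refl) , λ p → +ₚ-identityʳ p .at
              }
            ; inverse = (λ p n → trans (+ₚ-comm (-ₚ p) p .at n) (+ₚ-inverseʳ p .at n)) , λ p → +ₚ-inverseʳ p .at
            ; ⁻¹-cong = λ {p} {s} h n →
                trans (coeff-map -0#≈0# p n) (trans (-‿cong (h n)) (sym (coeff-map -0#≈0# s n)))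
            }
          ; comm = λ p s → +ₚ-comm p s .at
          }
        ; *-cong     = λ {p} {p′} {s} {s′} h h′ → *ₚ-cong {p} {p′} {s} {s′} (coeffwise h) (coeffwise h′) .at
        ; *-assoc    = λ p s u → *ₚ-assoc p s u .at
        ; *-identity = (λ p → *ₚ-identityˡ p .at) , λ p n → trans (*ₚ-comm p 1ₚ .at n) (*ₚ-identityˡ p .at n)
        ; distrib    = (λ p s u → *ₚ-distribˡ p s u .at) , λ p s u → *ₚ-distribʳ p s u .at
        }
      ; *-comm = λ p s → *ₚ-comm p s .at
      }
    }
    where
    +ₚ-comm : ∀ p s → p +ₚ s ≋ s +ₚ p
    +ₚ-comm p s .at n = trans (coeff-+ p s n) (trans (+-comm _ _) (sym (coeff-+ s p n)))

    +ₚ-identityʳ : ∀ p → p +ₚ [] ≋ p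
    +ₚ-identityʳ p .at n = trans (coeff-+ p [] n) (+-identityʳ _)

    +ₚ-assoc : ∀ p s u → (p +ₚ s) +ₚ u ≋ p +ₚ (s +ₚ u)
    +ₚ-assoc p s u .at n = begin
      coeff ((p +ₚ s) +ₚ u) n                ≈⟨ coeff-+ (p +ₚ s) u n ⟩
      coeff (p +ₚ s) n + coeff u n           ≈⟨ +-congʳ (coeff-+ p s n) ⟩
      (coeff p n + coeff s n) + coeff u n    ≈⟨ +-assoc _ _ _ ⟩
      coeff p n + (coeff s n + coeff u n)    ≈⟨ +-congˡ (coeff-+ s u n) ⟨
      coeff p n + coeff (s +ₚ u) n           ≈⟨ coeff-+ p (s +ₚ u) n ⟨
      coeff (p +ₚ (s +ₚ u)) n ∎
      where open SetoidReasoning setoid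

    +ₚ-inverseʳ : ∀ p → p +ₚ (-ₚ p) ≋ []
    +ₚ-inverseʳ p .at n = trans (coeff-+ p (-ₚ p) n)
      (trans (+-congˡ (coeff-map -0#≈0# p n)) (-‿inverseʳ _))

  eval-+ : ∀ p s x → eval (p +ₚ s) x ≈ eval p x + eval s x
  eval-+ []      s       x = sym (+-identityˡ _)
  eval-+ (a ∷ p) []      x = sym (+-identityʳ _)
  eval-+ (a ∷ p) (b ∷ s) x = begin
    (a + b) + x * eval (p +ₚ s) x               ≈⟨ +-congˡ (trans (*-congˡ (eval-+ p s x)) (distribˡ x _ _)) ⟩
    (a + b) + (x * eval p x + x * eval s x)     ≈⟨ interchange _ _ _ _ ⟩
    (a + x * eval p x) + (b + x * eval s x) ∎
    where open SetoidReasoning setoid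

  eval-scale : ∀ a p x → eval (map (a *_) p) x ≈ a * eval p x
  eval-scale a []      x = sym (zeroʳ a)
  eval-scale a (b ∷ p) x = begin
    a * b + x * eval (map (a *_) p) x    ≈⟨ +-congˡ (trans (*-congˡ (eval-scale a p x)) (x*yz≈y*xz x a _)) ⟩
    a * b + a * (x * eval p x)           ≈⟨ distribˡ a _ _ ⟨
    a * (b + x * eval p x) ∎
    where open SetoidReasoning setoid

  eval-* : ∀ p s x → eval (p *ₚ s) x ≈ eval p x * eval s x
  eval-* []      s x = sym (zeroˡ _)
  eval-* (a ∷ p) s x = begin
    eval (map (a *_) s +ₚ (0# ∷ (p *ₚ s))) x                ≈⟨ eval-+ (map (a *_) s) (0# ∷ (p *ₚ s)) x ⟩
    eval (map (a *_) s) x + (0# + x * eval (p *ₚ s) x)      ≈⟨ +-cong (eval-scale a s x) (trans (+-identityˡ _) (*-congˡ (eval-* p s x))) ⟩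
    a * eval s x + x * (eval p x * eval s x)                ≈⟨ +-congˡ (*-assoc x _ _) ⟨
    a * eval s x + (x * eval p x) * eval s x                ≈⟨ distribʳ (eval s x) a _ ⟨
    (a + x * eval p x) * eval s x ∎
    where open SetoidReasoning setoid

  -- Equal polynomials may differ by trailing zeros; this handles the overhang of the longer list in
  -- `eval-cong`.
  eval-zero : ∀ {p} → p ≋ [] → ∀ x → eval p x ≈ 0#
  eval-zero {[]}    h x = refl
  eval-zero {a ∷ p} h x =
    trans (+-cong (h .at 0) (trans (*-congˡ (eval-zero {p} (coeffwise λ n → h .at (suc n)) x)) (zeroʳ x))) (+-identityˡ 0#)

  eval-cong : ∀ {p s} → p ≋ s → ∀ x → eval p x ≈ eval s x
  eval-cong {[]}    {s}     h x = sym (eval-zero (≋.sym h) x)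
  eval-cong {a ∷ p} {[]}    h x = eval-zero h x
  eval-cong {a ∷ p} {b ∷ s} h x = +-cong (h .at 0) (*-congˡ (eval-cong {p} {s} (coeffwise λ n → h .at (suc n)) x))

-- Finite sums

module ListSum {c ℓ} (R : CommutativeRing c ℓ) where
  open CommutativeRing R
  open import Algebra.Properties.CommutativeSemigroup +-commutativeSemigroup using (interchange)
  open SetoidReasoning setoid

  private variable
    A B C P Q : Set

  infix 5 [_]_
  -- The Iverson bracket as a coefficient.
  [_]_ : Dec P → Carrier → Carrier
  [ P? ] x = if does P? then x else 0#

  []-cong : ∀ (P? : Dec P) {x y} → x ≈ y → [ P? ] x ≈ [ P? ] y
  []-cong (yes _) h = h
  []-cong (no _)  h = refl

  []-true : ∀ (P? : Dec P) {x} → P → [ P? ] x ≈ x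
  []-true (yes _)  p = refl
  []-true (no ¬p)  p = contradiction p ¬p

  []-false : ∀ (P? : Dec P) {x} → ¬ P → [ P? ] x ≈ 0#
  []-false (yes p) ¬p = contradiction p ¬p
  []-false (no _)  ¬p = refl

  []-zero : ∀ (P? : Dec P) → [ P? ] 0# ≈ 0#
  []-zero (yes _) = refl
  []-zero (no _)  = refl

  []-⇔ : ∀ (P? : Dec P) (Q? : Dec Q) {x} → (P → Q) → (Q → P) → [ P? ] x ≈ [ Q? ] x
  []-⇔ (yes p) Q? f g = sym ([]-true Q? (f p))
  []-⇔ (no ¬p) Q? f g = sym ([]-false Q? (¬p ∘ g))

  []-× : ∀ (P? : Dec P) (Q? : Dec Q) {x} → [ P? ×-dec Q? ] x ≈ [ P? ] [ Q? ] x
  []-× (yes _) (yes _) = refl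
  []-× (yes _) (no _)  = refl
  []-× (no _)  Q?      = refl

  *-[] : ∀ a (P? : Dec P) {x} → a * ([ P? ] x) ≈ [ P? ] (a * x)
  *-[] a (yes _) = refl
  *-[] a (no _)  = zeroʳ a

  [<suc] : ∀ k n x → [ k <? suc n ] x ≈ ([ k <? n ] x) + ([ k ≟ n ] x)
  [<suc] k n x with ℕ.<-cmp k n
  ... | tri< k<n k≢n _ = begin
    [ k <? suc n ] x                    ≈⟨ []-true (k <? suc n) (ℕ.m<n⇒m<1+n k<n) ⟩
    x                                   ≈⟨ +-identityʳ x ⟨
    x + 0#                              ≈⟨ +-cong ([]-true (k <? n) k<n) ([]-false (k ≟ n) k≢n) ⟨
    ([ k <? n ] x) + ([ k ≟ n ] x) ∎
  ... | tri≈ k≮n k≡n _ = begin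
    [ k <? suc n ] x                    ≈⟨ []-true (k <? suc n) (ℕ.s≤s (ℕ.≤-reflexive k≡n)) ⟩
    x                                   ≈⟨ +-identityˡ x ⟨
    0# + x                              ≈⟨ +-cong ([]-false (k <? n) k≮n) ([]-true (k ≟ n) k≡n) ⟨
    ([ k <? n ] x) + ([ k ≟ n ] x) ∎
  ... | tri> k≮n k≢n n<k = begin
    [ k <? suc n ] x                    ≈⟨ []-false (k <? suc n) (ℕ.≤⇒≯ n<k) ⟩
    0#                                  ≈⟨ +-identityˡ 0# ⟨
    0# + 0#                             ≈⟨ +-cong ([]-false (k <? n) k≮n) ([]-false (k ≟ n) k≢n) ⟨
    ([ k <? n ] x) + ([ k ≟ n ] x) ∎

  ∑ : List A → (A → Carrier) → Carrier
  ∑ xs f = foldr _+_ 0# (map f xs)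

  ∑-cong : ∀ xs {f g : A → Carrier} → (∀ x → f x ≈ g x) → ∑ xs f ≈ ∑ xs g
  ∑-cong []       h = refl
  ∑-cong (x ∷ xs) h = +-cong (h x) (∑-cong xs h)

  ∑-zero : ∀ (xs : List A) → ∑ xs (λ _ → 0#) ≈ 0#
  ∑-zero []       = refl
  ∑-zero (x ∷ xs) = trans (+-identityˡ _) (∑-zero xs)

  ∑-+ : ∀ xs (f g : A → Carrier) → ∑ xs (λ x → f x + g x) ≈ ∑ xs f + ∑ xs g
  ∑-+ []       f g = sym (+-identityˡ 0#)
  ∑-+ (x ∷ xs) f g = trans (+-congˡ (∑-+ xs f g)) (interchange _ _ _ _)

  *-∑ : ∀ a xs (f : A → Carrier) → a * ∑ xs f ≈ ∑ xs (λ x → a * f x)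
  *-∑ a []       f = zeroʳ a
  *-∑ a (x ∷ xs) f = trans (distribˡ a _ _) (+-congˡ (*-∑ a xs f))

  []-∑ : ∀ (P? : Dec P) xs (f : A → Carrier) → [ P? ] ∑ xs f ≈ ∑ xs (λ x → [ P? ] f x)
  []-∑ (yes _) xs f = refl
  []-∑ (no _)  xs f = sym (∑-zero xs)

  ∑-++ : ∀ xs ys (f : A → Carrier) → ∑ (xs ++ ys) f ≈ ∑ xs f + ∑ ys f
  ∑-++ []       ys f = sym (+-identityˡ _)
  ∑-++ (x ∷ xs) ys f = trans (+-congˡ (∑-++ xs ys f)) (sym (+-assoc _ _ _))

  ∑-filter : ∀ {P : A → Set} (P? : ∀ x → Dec (P x)) xs (f : A → Carrier) →
             ∑ (filter P? xs) f ≈ ∑ xs (λ x → [ P? x ] f x)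
  ∑-filter P? []       f = refl
  ∑-filter P? (x ∷ xs) f with P? x
  ... | yes _ = +-congˡ (∑-filter P? xs f)
  ... | no _  = trans (∑-filter P? xs f) (sym (+-identityˡ _))

  ∑-map : ∀ (h : A → B) xs (f : B → Carrier) → ∑ (map h xs) f ≈ ∑ xs (f ∘ h)
  ∑-map h []       f = refl
  ∑-map h (x ∷ xs) f = +-congˡ (∑-map h xs f)

  ∑-cartesianProductWith : ∀ (h : A → B → C) xs ys (f : C → Carrier) →
    ∑ (cartesianProductWith h xs ys) f ≈ ∑ xs (λ x → ∑ ys (λ y → f (h x y)))
  ∑-cartesianProductWith h []       ys f = refl
  ∑-cartesianProductWith h (x ∷ xs) ys f = trans (∑-++ (map (h x) ys) _ f)
    (+-cong (∑-map (h x) ys f) (∑-cartesianProductWith h xs ys f))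

  ∑-[]-none : ∀ {P : A → Set} (P? : ∀ x → Dec (P x)) {xs} (f : A → Carrier) →
              All (¬_ ∘ P) xs → ∑ xs (λ x → [ P? x ] f x) ≈ 0#
  ∑-[]-none P? f []         = refl
  ∑-[]-none P? f (¬p ∷ ¬ps) =
    trans (+-cong ([]-false (P? _) ¬p) (∑-[]-none P? f ¬ps)) (+-identityˡ 0#)

  -- A list without repetitions counts the selected element once.
  ∑-[]-one : ∀ {P : A → Set} (P? : ∀ x → Dec (P x)) {xs x₀} (f : A → Carrier) →
             Unique xs → x₀ ∈ xs → P x₀ → (∀ {x} → P x → x ≡ x₀) →
             ∑ xs (λ x → [ P? x ] f x) ≈ f x₀
  ∑-[]-one {P = P} P? {x ∷ xs} f (x∉ ∷ u) (here ≡.refl) px only =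
    trans (+-cong ([]-true (P? x) px) (∑-[]-none P? f (none x∉))) (+-identityʳ _)
    where
    none : ∀ {ys} → All (x ≢_) ys → All (¬_ ∘ P) ys
    none []        = []
    none (x≢y ∷ a) = (λ py → x≢y (≡.sym (only py))) ∷ none a
  ∑-[]-one P? {x ∷ xs} {x₀} f (x∉ ∷ u) (there x₀∈) px only =
    trans (+-cong ([]-false (P? x) (λ p → avoid x∉ x₀∈ (only p))) (∑-[]-one P? f u x₀∈ px only)) (+-identityˡ _)
    where
    avoid : ∀ {ys} → All (x ≢_) ys → x₀ ∈ ys → x ≢ x₀
    avoid (x≢y ∷ a) (here ≡.refl) = x≢y
    avoid (x≢y ∷ a) (there i)     = avoid a i

  -- The last summand is split off, so that enlarging a range by one is a definitional unfolding, as
  -- `Y-suc` and `row-suc` require.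
  ∑< : ℕ → (ℕ → Carrier) → Carrier
  ∑< zero    f = 0#
  ∑< (suc n) f = ∑< n f + f n

  ∑<-cong : ∀ n {f g : ℕ → Carrier} → (∀ i → f i ≈ g i) → ∑< n f ≈ ∑< n g
  ∑<-cong zero    h = refl
  ∑<-cong (suc n) h = +-cong (∑<-cong n h) (h n)

  ∑-by-value : ∀ (a : A → ℕ) xs (f : A → Carrier) n →
    ∑ xs (λ x → [ a x <? n ] f x) ≈ ∑< n (λ i → ∑ xs (λ x → [ a x ≟ i ] f x))
  ∑-by-value a xs f zero    = trans (∑-cong xs (λ x → []-false (a x <? 0) {f x} λ ())) (∑-zero xs)
  ∑-by-value a xs f (suc n) = begin
    ∑ xs (λ x → [ a x <? suc n ] f x)
      ≈⟨ ∑-cong xs (λ x → [<suc] (a x) n (f x)) ⟩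
    ∑ xs (λ x → ([ a x <? n ] f x) + ([ a x ≟ n ] f x))
      ≈⟨ ∑-+ xs _ _ ⟩
    ∑ xs (λ x → [ a x <? n ] f x) + ∑ xs (λ x → [ a x ≟ n ] f x)
      ≈⟨ +-congʳ (∑-by-value a xs f n) ⟩
    ∑< n (λ i → ∑ xs (λ x → [ a x ≟ i ] f x)) + ∑ xs (λ x → [ a x ≟ n ] f x) ∎

  []-swap : ∀ (P? : Dec P) (Q? : Dec Q) {x} → [ P? ] [ Q? ] x ≈ [ Q? ] [ P? ] x
  []-swap (yes _) Q? = refl
  []-swap (no _)  Q? = sym ([]-zero Q?)

  -- Converts a sum over roots into the double sum over coordinates by which `Y` is defined.
  ∑-by-values : ∀ (a b : A → ℕ) xs (f : A → Carrier) m n →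
    ∑ xs (λ x → [ a x <? m ] [ b x <? n ] f x) ≈
    ∑< m (λ i → ∑< n (λ j → ∑ xs (λ x → [ (a x ≟ i) ×-dec (b x ≟ j) ] f x)))
  ∑-by-values a b xs f m n = trans (∑-by-value a xs _ m) (∑<-cong m (λ i → begin
    ∑ xs (λ x → [ a x ≟ i ] [ b x <? n ] f x)
      ≈⟨ ∑-cong xs (λ x → []-swap (a x ≟ i) (b x <? n)) ⟩
    ∑ xs (λ x → [ b x <? n ] [ a x ≟ i ] f x)
      ≈⟨ ∑-by-value b xs _ n ⟩
    ∑< n (λ j → ∑ xs (λ x → [ b x ≟ j ] [ a x ≟ i ] f x))
      ≈⟨ ∑<-cong n (λ j → ∑-cong xs (λ x →
           trans ([]-swap (b x ≟ j) (a x ≟ i) {f x}) (sym ([]-× (a x ≟ i) (b x ≟ j))))) ⟩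
    ∑< n (λ j → ∑ xs (λ x → [ (a x ≟ i) ×-dec (b x ≟ j) ] f x)) ∎))

  ∑<-cong-< : ∀ n {f g : ℕ → Carrier} → (∀ {i} → i ℕ.< n → f i ≈ g i) → ∑< n f ≈ ∑< n g
  ∑<-cong-< zero    h = refl
  ∑<-cong-< (suc n) h = +-cong (∑<-cong-< n (λ i<n → h (ℕ.m<n⇒m<1+n i<n))) (h (ℕ.n<1+n n))

  ∑-upTo : ∀ n f → ∑ (upTo n) f ≈ ∑< n f
  ∑-upTo zero    f = refl
  ∑-upTo (suc n) f = trans (reflexive (≡.cong (λ is → ∑ is f) (≡.sym (upTo-∷ʳ n))))
    (trans (∑-++ (upTo n) (n ∷ []) f) (+-cong (∑-upTo n f) (+-identityʳ (f n))))

-- Power series and the chain recurrences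

module PowerSeries {c ℓ} (R : CommutativeRing c ℓ) where
  open CommutativeRing R hiding (rawRing)
  open ListSum R
  open PolynomialRing R using (coeff-∷*-zero; coeff-∷*-suc)
  open Polynomial (CommutativeRing.rawRing R)
  open RawRing rawRing using () renaming (1# to 1ₚ; -_ to -ₚ_)
  open import Algebra.Properties.CommutativeSemigroup +-commutativeSemigroup using (interchange)
  open import Algebra.Properties.CommutativeSemigroup *-commutativeSemigroup using (x∙yz≈y∙xz)
  open import Algebra.Properties.Ring ring using (-0#≈0#; -‿distribˡ-*; -‿distribʳ-*)
  open import Algebra.Properties.AbelianGroup +-abelianGroup using (⁻¹-∙-comm; ∙-cancelʳ)
  open SetoidReasoning setoid

  infix 4 _≗_
  _≗_ : Series → Series → Set ℓ
  f ≗ g = ∀ k → f k ≈ g k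

  infixl 6 _⊞_
  _⊞_ : Series → Series → Series
  (f ⊞ g) k = f k + g k

  -- The constant series 1.
  δ : Series
  δ zero    = 1#
  δ (suc _) = 0#

  infixr 7 _t∙_
  _t∙_ : Carrier → Series → Series
  (x t∙ f) zero    = 0#
  (x t∙ f) (suc k) = x * f k

  -- Multiplication by 1 - x t.
  ∆ : Carrier → Series → Series
  ∆ x f k = f k - (x t∙ f) k

  t∙-cong : ∀ x {f g} → f ≗ g → x t∙ f ≗ x t∙ g
  t∙-cong x h zero    = refl
  t∙-cong x h (suc k) = *-congˡ (h k)

  ∆-cong : ∀ x {f g} → f ≗ g → ∆ x f ≗ ∆ x g
  ∆-cong x h k = +-cong (h k) (-‿cong (t∙-cong x h k))

  ∆-⊞ : ∀ x f g → ∆ x (f ⊞ g) ≗ ∆ x f ⊞ ∆ x g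
  ∆-⊞ x f g k = trans (+-congˡ (trans (-‿cong (t∙-⊞ k)) (sym (⁻¹-∙-comm _ _)))) (interchange _ _ _ _)
    where
    t∙-⊞ : x t∙ (f ⊞ g) ≗ x t∙ f ⊞ x t∙ g
    t∙-⊞ zero    = sym (+-identityˡ 0#)
    t∙-⊞ (suc k) = distribˡ x _ _

  t∙-∆ : ∀ x y f → x t∙ ∆ y f ≗ λ k → (x t∙ f) k - (x t∙ (y t∙ f)) k
  t∙-∆ x y f zero    = sym (-‿inverseʳ 0#)
  t∙-∆ x y f (suc k) = trans (distribˡ x _ _) (+-congˡ (sym (-‿distribʳ-* x _)))

  ∆-comm : ∀ x y f → ∆ x (∆ y f) ≗ ∆ y (∆ x f)
  ∆-comm x y f k = begin
    (f k - yf) - (x t∙ ∆ y f) k              ≈⟨ expand x y ⟩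
    (f k - yf) + (- xf - - xyf)              ≈⟨ interchange _ _ _ _ ⟩
    (f k - xf) + (- yf - - xyf)              ≈⟨ +-congˡ (+-congˡ (-‿cong (-‿cong (t∙-comm k)))) ⟩
    (f k - xf) + (- yf - - yxf)              ≈⟨ expand y x ⟨
    (f k - xf) - (y t∙ ∆ x f) k ∎
    where
    xf = (x t∙ f) k
    yf = (y t∙ f) k
    xyf = (x t∙ (y t∙ f)) k
    yxf = (y t∙ (x t∙ f)) k
    expand : ∀ x y → (f k - (y t∙ f) k) - (x t∙ ∆ y f) k ≈
                     (f k - (y t∙ f) k) + (- (x t∙ f) k - - (x t∙ (y t∙ f)) k)
    expand x y = +-congˡ (trans (-‿cong (t∙-∆ x y f k)) (sym (⁻¹-∙-comm _ _)))
    t∙-comm : x t∙ (y t∙ f) ≗ y t∙ (x t∙ f)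
    t∙-comm zero          = refl
    t∙-comm (suc zero)    = trans (zeroʳ x) (sym (zeroʳ y))
    t∙-comm (suc (suc k)) = x∙yz≈y∙xz x y (f k)

  ∆-+t∙ : ∀ x f → ∆ x f ⊞ x t∙ f ≗ f
  ∆-+t∙ x f k = trans (+-assoc _ _ _) (trans (+-congˡ (-‿inverseˡ _)) (+-identityʳ _))

  *ₛ-congˡ : ∀ f {g g′} → g ≗ g′ → f *ₛ g ≗ f *ₛ g′
  *ₛ-congˡ f h n = ∑-cong (upTo (suc n)) (λ i → *-congˡ (h (n ℕ.∸ i)))

  *ₛ-⊞ : ∀ f g g′ → f *ₛ (g ⊞ g′) ≗ f *ₛ g ⊞ f *ₛ g′
  *ₛ-⊞ f g g′ n = trans (∑-cong (upTo (suc n)) (λ i → distribˡ (f i) _ _)) (∑-+ (upTo (suc n)) _ _)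

  ∑<-last : ∀ n f → (∀ {i} → i ℕ.< n → f i ≈ 0#) → ∑< (suc n) f ≈ f n
  ∑<-last n f h = trans (+-congʳ (vanish n h)) (+-identityˡ (f n))
    where
    vanish : ∀ n → (∀ {i} → i ℕ.< n → f i ≈ 0#) → ∑< n f ≈ 0#
    vanish zero    h = refl
    vanish (suc n) h = trans (+-cong (vanish n (λ i<n → h (ℕ.m<n⇒m<1+n i<n))) (h (ℕ.n<1+n n))) (+-identityˡ 0#)

  δ-positive : ∀ {n} → 0 ℕ.< n → δ n ≈ 0#
  δ-positive (s≤s _) = refl

  *ₛ-δ : ∀ f → f *ₛ δ ≗ f
  *ₛ-δ f n = begin
    (f *ₛ δ) n                                 ≈⟨ ∑-upTo (suc n) _ ⟩
    ∑< (suc n) (λ i → f i * δ (n ℕ.∸ i))       ≈⟨ ∑<-last n _ (λ i<n → trans (*-congˡ (δ-positive (ℕ.m<n⇒0<n∸m i<n))) (zeroʳ _)) ⟩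
    f n * δ (n ℕ.∸ n)                          ≈⟨ *-congˡ (reflexive (≡.cong δ (ℕ.n∸n≡0 n))) ⟩
    f n * 1#                                   ≈⟨ *-identityʳ (f n) ⟩
    f n ∎

  *ₛ-t∙ : ∀ x f g → f *ₛ (x t∙ g) ≗ x t∙ (f *ₛ g)
  *ₛ-t∙ x f g zero    = trans (+-identityʳ _) (zeroʳ (f 0))
  *ₛ-t∙ x f g (suc n) = begin
    (f *ₛ (x t∙ g)) (suc n)
      ≈⟨ ∑-upTo (suc (suc n)) _ ⟩
    ∑< (suc n) (λ i → f i * (x t∙ g) (suc n ℕ.∸ i)) + f (suc n) * (x t∙ g) (n ℕ.∸ n)
      ≈⟨ +-cong (∑<-cong-< (suc n) inner) (trans (*-congˡ (reflexive (≡.cong (x t∙ g) (ℕ.n∸n≡0 n)))) (zeroʳ _)) ⟩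
    ∑< (suc n) (λ i → x * (f i * g (n ℕ.∸ i))) + 0#
      ≈⟨ trans (+-identityʳ _) (sym (∑-upTo (suc n) _)) ⟩
    ∑ (upTo (suc n)) (λ i → x * (f i * g (n ℕ.∸ i)))
      ≈⟨ *-∑ x (upTo (suc n)) _ ⟨
    x * (f *ₛ g) n ∎
    where
    inner : ∀ {i} → i ℕ.< suc n → f i * (x t∙ g) (suc n ℕ.∸ i) ≈ x * (f i * g (n ℕ.∸ i))
    inner {i} (s≤s i≤n) = trans (*-congˡ (reflexive (≡.cong (x t∙ g) (ℕ.+-∸-assoc 1 i≤n)))) (x∙yz≈y∙xz (f i) x _)

  -- Distributing over the subtraction in `∆` is avoided: both sides become `f *ₛ g` once
  -- `x t∙ (f *ₛ g)` is added.
  *ₛ-∆ : ∀ x f g → f *ₛ ∆ x g ≗ ∆ x (f *ₛ g)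
  *ₛ-∆ x f g k = ∙-cancelʳ ((x t∙ (f *ₛ g)) k) _ _ (begin
    (f *ₛ ∆ x g) k + (x t∙ (f *ₛ g)) k       ≈⟨ +-congˡ (*ₛ-t∙ x f g k) ⟨
    (f *ₛ ∆ x g) k + (f *ₛ (x t∙ g)) k       ≈⟨ *ₛ-⊞ f (∆ x g) (x t∙ g) k ⟨
    (f *ₛ (∆ x g ⊞ x t∙ g)) k                ≈⟨ *ₛ-congˡ f (∆-+t∙ x g) k ⟩
    (f *ₛ g) k                               ≈⟨ ∆-+t∙ x (f *ₛ g) k ⟨
    ∆ x (f *ₛ g) k + (x t∙ (f *ₛ g)) k ∎)

  -- Written in the shape of `factor`, so that the denominator of the problem agrees with a product
  -- of these by computation.
  1-_t : Carrier → Poly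
  1- x t = 1ₚ +ₚ (-ₚ (constant x *ₚ X))

  coeff-1-xt : ∀ x p → coeff ((1- x t) *ₚ p) ≗ ∆ x (coeff p)
  coeff-1-xt x p k = trans (expand k) (+-cong (trans (*-congʳ unit) (*-identityˡ _)) (lin k))
    where
    -- The unreduced coefficients to which `1- x t` computes: it unfolds to `u ∷ v ∷ []`.
    u v : Carrier
    u = 1# + - (x * 0# + 0#)
    v = - (x * 1#)
    unit : u ≈ 1#
    unit = trans (+-congˡ (trans (-‿cong (trans (+-identityʳ _) (zeroʳ x))) -0#≈0#)) (+-identityʳ 1#)
    tail-term : Series
    tail-term zero    = 0#
    tail-term (suc n) = coeff ((v ∷ []) *ₚ p) n
    expand : ∀ k → coeff ((u ∷ v ∷ []) *ₚ p) k ≈ u * coeff p k + tail-term k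
    expand zero    = trans (coeff-∷*-zero u (v ∷ []) p) (sym (+-identityʳ _))
    expand (suc n) = coeff-∷*-suc u (v ∷ []) p n
    v* : ∀ n → v * coeff p n ≈ - (x * coeff p n)
    v* n = trans (*-congʳ (-‿cong (*-identityʳ x))) (sym (-‿distribˡ-* x _))
    lin : ∀ k → tail-term k ≈ - (x t∙ coeff p) k
    lin zero          = sym -0#≈0#
    lin (suc zero)    = trans (coeff-∷*-zero v [] p) (v* 0)
    lin (suc (suc n)) = trans (coeff-∷*-suc v [] p n) (trans (+-identityʳ _) (v* (suc n)))

  *ₛ-factors : ∀ {A : Set} (x : A → Carrier) as f →
    f *ₛ coeff (foldr _*ₚ_ 1ₚ (map (λ a → 1- x a t) as)) ≗ foldr (λ a → ∆ (x a)) f as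
  *ₛ-factors x []       f k = trans (*ₛ-congˡ f one k) (*ₛ-δ f k)
    where
    one : coeff 1ₚ ≗ δ
    one zero    = refl
    one (suc n) = refl
  *ₛ-factors x (a ∷ as) f k = begin
    (f *ₛ coeff ((1- x a t) *ₚ p)) k         ≈⟨ *ₛ-congˡ f (coeff-1-xt (x a) p) k ⟩
    (f *ₛ ∆ (x a) (coeff p)) k               ≈⟨ *ₛ-∆ (x a) f (coeff p) k ⟩
    ∆ (x a) (f *ₛ coeff p) k                 ≈⟨ ∆-cong (x a) (*ₛ-factors x as f) k ⟩
    ∆ (x a) (foldr (λ a → ∆ (x a)) f as) k ∎
    where p = foldr _*ₚ_ 1ₚ (map (λ a → 1- x a t) as)

-- Numerators of up-sets in the coordinate staircase

module Chains {c ℓ} (R : CommutativeRing c ℓ) (w : ℕ → CommutativeRing.Carrier R) (h : ℕ) where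
  open CommutativeRing R hiding (rawRing)
  open ListSum R
  open PowerSeries R
  open Polynomial (CommutativeRing.rawRing R) using (Series)
  open import Algebra.Properties.Group +-group using (∙-cancelʳ)
  open SetoidReasoning setoid

  -- Multiplication by the factors `1 - w s t` for the coordinate sums `s < n`. The up-set of
  -- `(i , c)` contains only sums up to `i + c`, so `D (suc (i ℕ.+ c))` clears its denominator.
  D : ℕ → Series → Series
  D zero    f = f
  D (suc n) f = ∆ (w n) (D n f)

  D-cong : ∀ n {f g} → f ≗ g → D n f ≗ D n g
  D-cong zero    h = h
  D-cong (suc n) h = ∆-cong (w n) (D-cong n h)

  D-⊞ : ∀ n f g → D n (f ⊞ g) ≗ D n f ⊞ D n g
  D-⊞ zero    f g k = refl
  D-⊞ (suc n) f g k = trans (∆-cong (w n) (D-⊞ n f g) k) (∆-⊞ (w n) (D n f) (D n g) k)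

  D-∆ : ∀ n x f → D n (∆ x f) ≗ ∆ x (D n f)
  D-∆ zero    x f k = refl
  D-∆ (suc n) x f k = trans (∆-cong (w n) (D-∆ n x f) k) (∆-comm (w n) x (D n f) k)

  Valid : ℕ → ℕ → Set
  Valid i c = i ℕ.≤ c × i ℕ.+ c ℕ.≤ h

  valid? : ∀ i c → Dec (Valid i c)
  valid? i c = (i ℕ.≤? c) ×-dec (i ℕ.+ c ℕ.≤? h)

  -- The weighted number of weak chains of length k among the elements with
  -- coordinates strictly below (i , c); the strict bounds make the empty
  -- up-set available as Y 0 c.
  Y : ℕ → ℕ → Series
  Y i c zero    = 1#
  Y i c (suc k) = ∑< i λ i′ → ∑< c λ c′ → [ valid? i′ c′ ] (w (i′ ℕ.+ c′) * Y (suc i′) (suc c′) k)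

  -- The contribution to `Y` of the nonempty chains whose least element in the poset is `(i , c)`,
  -- respectively has first coordinate `i` and second coordinate below `c`.
  point row : ℕ → ℕ → Series
  point i c zero    = 0#
  point i c (suc k) = [ valid? i c ] (w (i ℕ.+ c) * Y (suc i) (suc c) k)
  row i c zero      = 0#
  row i c (suc k)   = ∑< c λ c′ → point i c′ (suc k)

  point-valid : ∀ {i c} → Valid i c → point i c ≗ w (i ℕ.+ c) t∙ Y (suc i) (suc c)
  point-valid         v zero    = refl
  point-valid {i} {c} v (suc k) = []-true (valid? i c) v

  point-invalid : ∀ {i c} → ¬ Valid i c → ∀ k → point i c k ≈ 0#
  point-invalid         ¬v zero    = refl
  point-invalid {i} {c} ¬v (suc k) = []-false (valid? i c) ¬v

  Y-suc : ∀ i c → Y (suc i) c ≗ Y i c ⊞ row i c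
  Y-suc i c zero    = sym (+-identityʳ 1#)
  Y-suc i c (suc k) = refl

  Y-zeroˡ : ∀ c → Y 0 c ≗ δ
  Y-zeroˡ c zero    = refl
  Y-zeroˡ c (suc k) = refl

  row-zero : ∀ i k → row i 0 k ≈ 0#
  row-zero i zero    = refl
  row-zero i (suc k) = refl

  row-suc : ∀ i c → row i (suc c) ≗ row i c ⊞ point i c
  row-suc i c zero    = sym (+-identityˡ 0#)
  row-suc i c (suc k) = refl

  row-suc-invalid : ∀ {i c} → ¬ Valid i c → row i (suc c) ≗ row i c
  row-suc-invalid {i} {c} ¬v k = trans (row-suc i c k) (trans (+-congˡ (point-invalid ¬v k)) (+-identityʳ _))

  row-low : ∀ {i} c → c ℕ.≤ i → ∀ k → row i c k ≈ 0#
  row-low     zero    c≤i k = row-zero _ k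
  row-low {i} (suc c) c<i k = trans (row-suc-invalid (λ (i≤c , _) → ℕ.<⇒≱ c<i i≤c) k) (row-low c (ℕ.<⇒≤ c<i) k)

  -- Points beyond the antidiagonal contribute nothing. This lets the common bound `suc h` of all
  -- rows in `N` be cut down to the actual end of a row.
  row-high : ∀ {i c} → h ℕ.< i ℕ.+ c → ∀ d → row i (d ℕ.+ c) ≗ row i c
  row-high         h<i+c zero    k = refl
  row-high {i} {c} h<i+c (suc d) k = trans
    (row-suc-invalid (λ (_ , ≤h) → ℕ.<⇒≱ (ℕ.<-≤-trans h<i+c (ℕ.+-monoʳ-≤ i (ℕ.m≤n+m c d))) ≤h) k)
    (row-high h<i+c d k)

  -- Inclusion-exclusion for the up-set of the element (i , c).
  Y-step : ∀ {i c} → Valid i c →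
           ∆ (w (i ℕ.+ c)) (Y (suc i) (suc c)) ⊞ Y i c ≗ Y i (suc c) ⊞ Y (suc i) c
  Y-step {i} {c} v k = begin
    ∆ x Y₁₁ k + Y i c k
      ≈⟨ +-congʳ (+-congʳ expand) ⟩
    ((Y i (suc c) k + row i c k) + (x t∙ Y₁₁) k - (x t∙ Y₁₁) k) + Y i c k
      ≈⟨ +-congʳ (trans (+-assoc _ _ _) (trans (+-congˡ (-‿inverseʳ _)) (+-identityʳ _))) ⟩
    (Y i (suc c) k + row i c k) + Y i c k
      ≈⟨ trans (+-assoc _ _ _) (+-congˡ (+-comm _ _)) ⟩
    Y i (suc c) k + (Y i c k + row i c k)
      ≈⟨ +-congˡ (Y-suc i c k) ⟨
    Y i (suc c) k + Y (suc i) c k ∎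
    where
    x = w (i ℕ.+ c)
    Y₁₁ = Y (suc i) (suc c)
    expand : Y₁₁ k ≈ (Y i (suc c) k + row i c k) + (x t∙ Y₁₁) k
    expand = begin
      Y₁₁ k                                         ≈⟨ Y-suc i (suc c) k ⟩
      Y i (suc c) k + row i (suc c) k               ≈⟨ +-congˡ (trans (row-suc i c k) (+-congˡ (point-valid v k))) ⟩
      Y i (suc c) k + (row i c k + (x t∙ Y₁₁) k)    ≈⟨ +-assoc _ _ _ ⟨
      (Y i (suc c) k + row i c k) + (x t∙ Y₁₁) k ∎

  -- The numerator of the up-set of the element (i , c).
  M : ℕ → ℕ → Series
  M i c = D (suc (i ℕ.+ c)) (Y (suc i) (suc c))

  D-index : ∀ {m n} → m ≡ n → ∀ f → D m f ≗ D n f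
  D-index ≡.refl f k = refl

  -- `D n` commutes with `∆ (w n)`, and for `n = i + c` the factor on the left of `Y-step` is
  -- precisely the one by which `D (suc n)` exceeds `D n`.
  M-suc : ∀ {i c} → Valid i c →
          M i c ⊞ D (i ℕ.+ c) (Y i c) ≗ D (i ℕ.+ c) (Y i (suc c)) ⊞ D (i ℕ.+ c) (Y (suc i) c)
  M-suc {i} {c} v k = begin
    M i c k + D n (Y i c) k                                        ≈⟨ +-congʳ (D-∆ n (w n) (Y (suc i) (suc c)) k) ⟨
    D n (∆ (w n) (Y (suc i) (suc c))) k + D n (Y i c) k            ≈⟨ D-⊞ n _ _ k ⟨
    D n (∆ (w n) (Y (suc i) (suc c)) ⊞ Y i c) k                    ≈⟨ D-cong n (Y-step v) k ⟩
    D n (Y i (suc c) ⊞ Y (suc i) c) k                              ≈⟨ D-⊞ n _ _ k ⟩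
    D n (Y i (suc c)) k + D n (Y (suc i) c) k ∎
    where n = i ℕ.+ c

  -- The up-set of `(0 , c)` is totally ordered, and its series is the reciprocal of the denominator
  -- that `D` clears.
  M-zero : ∀ c → c ℕ.≤ h → M 0 c ≗ δ
  M-zero zero    _   k = ∙-cancelʳ (Y 0 0 k) _ _ (begin
    M 0 0 k + Y 0 0 k    ≈⟨ M-suc {0} {0} (z≤n , z≤n) k ⟩
    Y 0 1 k + Y 1 0 k    ≈⟨ +-cong (Y-zeroˡ 1 k) (trans (Y-suc 0 0 k) (trans (+-congˡ (row-zero 0 k)) (+-identityʳ _))) ⟩
    δ k + Y 0 0 k ∎)
  M-zero (suc c) c<h k = ∙-cancelʳ (D (suc c) (Y 0 (suc c)) k) _ _ (begin
    M 0 (suc c) k + D (suc c) (Y 0 (suc c)) k                    ≈⟨ M-suc {0} {suc c} (z≤n , c<h) k ⟩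
    D (suc c) (Y 0 (suc (suc c))) k + M 0 c k                    ≈⟨ +-comm _ _ ⟩
    M 0 c k + D (suc c) (Y 0 (suc (suc c))) k
      ≈⟨ +-cong (M-zero c (ℕ.<⇒≤ c<h) k)
                (D-cong (suc c) (λ k → trans (Y-zeroˡ (suc (suc c)) k) (sym (Y-zeroˡ (suc c) k))) k) ⟩
    δ k + D (suc c) (Y 0 (suc c)) k ∎)

  -- `(suc i , i)` lies off the staircase, so everything strictly above `(suc i , suc i)` is the
  -- up-set of `(i , suc i)`. Adjoining a minimum only adds a denominator factor.
  M-diag : ∀ {i} → suc i ℕ.+ suc i ℕ.≤ h → M (suc i) (suc i) ≗ M i (suc i)
  M-diag {i} ≤h k = ∙-cancelʳ (D n (Y (suc i) (suc i)) k) _ _ (begin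
    M (suc i) (suc i) k + D n (Y (suc i) (suc i)) k               ≈⟨ M-suc {suc i} {suc i} (ℕ.≤-refl , ≤h) k ⟩
    M i (suc i) k + D n (Y (suc (suc i)) (suc i)) k
      ≈⟨ +-congˡ (D-cong n (λ k → trans (Y-suc (suc i) (suc i) k)
           (trans (+-congˡ (row-low (suc i) ℕ.≤-refl k)) (+-identityʳ _))) k) ⟩
    M i (suc i) k + D n (Y (suc i) (suc i)) k ∎)
    where n = suc i ℕ.+ suc i

  -- In `M-suc` all terms are cleared by the same `D`. For the smallest up-set, that of `(i , c)`,
  -- this is one factor too many, and the surplus factor remains as `∆`.
  M-step : ∀ {i c} → Valid (suc i) (suc c) →
           M (suc i) (suc c) ⊞ ∆ (w (suc (i ℕ.+ c))) (M i c) ≗ M i (suc c) ⊞ M (suc i) c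
  M-step {i} {c} v k = begin
    M (suc i) (suc c) k + ∆ (w (suc (i ℕ.+ c))) (M i c) k        ≈⟨ +-congˡ (D-index n≡ (Y (suc i) (suc c)) k) ⟨
    M (suc i) (suc c) k + D n (Y (suc i) (suc c)) k              ≈⟨ M-suc v k ⟩
    M i (suc c) k + D n (Y (suc (suc i)) (suc c)) k              ≈⟨ +-congˡ (D-index n≡ (Y (suc (suc i)) (suc c)) k) ⟩
    M i (suc c) k + M (suc i) c k ∎
    where
    n = suc i ℕ.+ suc c
    n≡ : n ≡ suc (suc (i ℕ.+ c))
    n≡ = ≡.cong suc (ℕ.+-suc i c)

  -- The numerator of the set of all elements whose first coordinate is ≤ j.
  N : ℕ → Series
  N j = D (suc h) (Y (suc j) (suc h))

  N-zero : N 0 ≗ δ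
  N-zero = M-zero h ℕ.≤-refl

  -- The new row is also the difference between the sets `Y (suc (suc j)) (suc c)` and
  -- `Y (suc j) (suc c)`. The latter has coordinate sums up to `h - 1` only, so `D (suc h)` leaves
  -- the surplus factor `∆ (w h)`.
  N-step : ∀ {j c} → suc j ℕ.+ c ≡ h →
           N (suc j) ⊞ ∆ (w h) (M j c) ≗ N j ⊞ M (suc j) c
  N-step {j} {c} eq k = begin
    N (suc j) k + ∆ (w h) (M j c) k
      ≈⟨ +-cong (trans (D-cong (suc h) (Y-suc (suc j) (suc h)) k) (D-⊞ (suc h) _ _ k))
                (sym (∆-cong (w h) (D-index (≡.sym eq) (Y (suc j) (suc c))) k)) ⟩
    (N j k + D (suc h) (row (suc j) (suc h)) k) + D (suc h) (Y (suc j) (suc c)) k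
      ≈⟨ trans (+-assoc _ _ _) (+-congˡ (+-comm _ _)) ⟩
    N j k + (D (suc h) (Y (suc j) (suc c)) k + D (suc h) (row (suc j) (suc h)) k)
      ≈⟨ +-congˡ (+-congˡ (D-cong (suc h) row≗ k)) ⟩
    N j k + (D (suc h) (Y (suc j) (suc c)) k + D (suc h) (row (suc j) (suc c)) k)
      ≈⟨ +-congˡ (trans (D-cong (suc h) (Y-suc (suc j) (suc c)) k) (D-⊞ (suc h) _ _ k)) ⟨
    N j k + D (suc h) (Y (suc (suc j)) (suc c)) k
      ≈⟨ +-congˡ (D-index (≡.cong suc (≡.sym eq)) (Y (suc (suc j)) (suc c)) k) ⟩
    N j k + M (suc j) c k ∎
    where
    h<j+c : h ℕ.< suc j ℕ.+ suc c
    h<j+c = ℕ.≤-reflexive (≡.cong suc (≡.trans (≡.sym eq) (≡.sym (ℕ.+-suc j c))))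
    row≗ : row (suc j) (suc h) ≗ row (suc j) (suc c)
    row≗ k = trans (reflexive (≡.cong (λ n → row (suc j) n k)
      (≡.trans (≡.cong suc (≡.sym eq)) (≡.sym (ℕ.+-suc (suc j) c))))) (row-high h<j+c (suc j) k)

  -- Trades the subtraction in `∆` for an addition on the other side, so that a semiring
  -- homomorphism can be applied to the recurrences.
  unfold-∆ : ∀ {a s} x f k → a + ∆ x f k ≈ s → a + f k ≈ s + (x t∙ f) k
  unfold-∆ {a} {s} x f k eq = begin
    a + f k                          ≈⟨ +-congˡ (∆-+t∙ x f k) ⟨
    a + (∆ x f k + (x t∙ f) k)       ≈⟨ +-assoc _ _ _ ⟨
    (a + ∆ x f k) + (x t∙ f) k       ≈⟨ +-congʳ eq ⟩
    s + (x t∙ f) k ∎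

  M-step-coeff : ∀ {i c} → Valid (suc i) (suc c) → ∀ k →
    M (suc i) (suc c) k + M i c k ≈ (M i (suc c) k + M (suc i) c k) + (w (suc (i ℕ.+ c)) t∙ M i c) k
  M-step-coeff {i} {c} v k = unfold-∆ (w (suc (i ℕ.+ c))) (M i c) k (M-step v k)

  N-step-coeff : ∀ {j c} → suc j ℕ.+ c ≡ h → ∀ k →
    N (suc j) k + M j c k ≈ (N j k + M (suc j) c k) + (w h t∙ M j c) k
  N-step-coeff {j} {c} eq k = unfold-∆ (w h) (M j c) k (N-step eq k)

  x+0≈[0+0]+w0 : ∀ {x a b c d} w → a ≈ 0# → b ≈ 0# → c ≈ 0# → d ≈ 0# → x + a ≈ (b + c) + w * d → x ≈ 0#
  x+0≈[0+0]+w0 {x} {a} {b} {c} {d} w a0 b0 c0 d0 eq = begin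
    x                  ≈⟨ +-identityʳ x ⟨
    x + 0#             ≈⟨ +-congˡ a0 ⟨
    x + a              ≈⟨ eq ⟩
    (b + c) + w * d    ≈⟨ +-cong (trans (+-cong b0 c0) (+-identityˡ 0#)) (trans (*-congˡ d0) (zeroʳ w)) ⟩
    0# + 0#            ≈⟨ +-identityˡ 0# ⟩
    0# ∎

  valid-pred : ∀ {i c} → i ℕ.< c → suc i ℕ.+ suc c ℕ.≤ h → Valid i c × Valid i (suc c) × Valid (suc i) c
  valid-pred {i} {c} i<c ≤h =
    (ℕ.<⇒≤ i<c , ℕ.≤-trans (ℕ.+-mono-≤ (ℕ.n≤1+n i) (ℕ.n≤1+n c)) ≤h) ,
    (ℕ.m≤n⇒m≤1+n (ℕ.<⇒≤ i<c) , ℕ.≤-trans (ℕ.n≤1+n _) ≤h) ,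
    (i<c , ℕ.≤-trans (ℕ.+-monoʳ-≤ (suc i) (ℕ.n≤1+n c)) ≤h)

  -- Only the term with a factor t raises the degree, and it belongs to the preceding first
  -- coordinate; hence the degree is at most `i`, whatever `c` is.
  M-vanishes : ∀ i c → Valid i c → ∀ {k} → i ℕ.< k → M i c k ≈ 0#
  M-vanishes zero    c       (_ , c≤h)       {suc k} _           = M-zero c c≤h (suc k)
  M-vanishes (suc i) (suc c) (s≤s i≤c , ≤h)  {suc k} i<k@(s≤s i<k′) with ℕ.m≤n⇒m<n∨m≡n i≤c
  ... | inj₂ ≡.refl = trans (M-diag ≤h (suc k))
    (M-vanishes i (suc i) (ℕ.n≤1+n i , ℕ.≤-trans (ℕ.n≤1+n _) ≤h) (ℕ.<⇒≤ i<k))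
  ... | inj₁ i<c    = let v , v₀₁ , v₁₀ = valid-pred i<c ≤h in
    x+0≈[0+0]+w0 (w (suc (i ℕ.+ c)))
      (M-vanishes i c v (ℕ.<⇒≤ i<k))
      (M-vanishes i (suc c) v₀₁ (ℕ.<⇒≤ i<k))
      (M-vanishes (suc i) c v₁₀ i<k)
      (M-vanishes i c v i<k′)
      (M-step-coeff (s≤s i≤c , ≤h) (suc k))

  N-vanishes : ∀ j c → j ℕ.+ c ≡ h → j ℕ.≤ c → ∀ {k} → j ℕ.< k → N j k ≈ 0#
  N-vanishes zero    c _  _     {suc k} _   = N-zero (suc k)
  N-vanishes (suc j) c eq j<c {suc k} j<k@(s≤s j<k′) =
    x+0≈[0+0]+w0 (w h) (M-vanishes j c v (ℕ.<⇒≤ j<k))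
      (N-vanishes j (suc c) (≡.trans (ℕ.+-suc j c) eq) (ℕ.m≤n⇒m≤1+n (ℕ.<⇒≤ j<c)) (ℕ.<⇒≤ j<k))
      (M-vanishes (suc j) c (j<c , ℕ.≤-reflexive eq) j<k)
      (M-vanishes j c v j<k′)
      (N-step-coeff eq (suc k))
    where
    v : Valid j c
    v = ℕ.<⇒≤ j<c , ℕ.≤-trans (ℕ.n≤1+n _) (ℕ.≤-reflexive eq)

  -- The product of the weights `w (a + a)` of the diagonal points `(a , a)` with `1 ≤ a ≤ i`, the
  -- corners of the staircase path.
  topWeight : ℕ → Carrier
  topWeight zero    = 1#
  topWeight (suc i) = w (suc (i ℕ.+ suc i)) * topWeight i

  x+0≈[0+0]+y : ∀ {x a b c y} → a ≈ 0# → b ≈ 0# → c ≈ 0# → x + a ≈ (b + c) + y → x ≈ y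
  x+0≈[0+0]+y {x} {a} {b} {c} {y} a0 b0 c0 eq = begin
    x              ≈⟨ +-identityʳ x ⟨
    x + 0#         ≈⟨ +-congˡ a0 ⟨
    x + a          ≈⟨ eq ⟩
    (b + c) + y    ≈⟨ +-congʳ (trans (+-cong b0 c0) (+-identityˡ 0#)) ⟩
    0# + y         ≈⟨ +-identityˡ y ⟩
    y ∎

  -- Next to the diagonal the term `M (suc i) (suc i)` equals `M i (suc i)` and so has degree at
  -- most `i`. Of the recurrence only the term with a factor t reaches degree `suc i`.
  M-top : ∀ i → i ℕ.+ suc i ℕ.≤ h → M i (suc i) i ≈ topWeight i
  M-top zero    ≤h = M-zero 1 ≤h 0
  M-top (suc i) ≤h = let v , v₀₁ , v₁₀ = valid-pred (ℕ.n<1+n i) ≤h in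
    trans (x+0≈[0+0]+y
      (M-vanishes i (suc i) v (ℕ.n<1+n i))
      (M-vanishes i (suc (suc i)) v₀₁ (ℕ.n<1+n i))
      (trans (M-diag (proj₂ v₁₀) (suc i)) (M-vanishes i (suc i) v (ℕ.n<1+n i)))
      (M-step-coeff (ℕ.n≤1+n _ , ≤h) (suc i)))
    (*-congˡ (M-top i (proj₂ v)))

  N-top : ∀ m → m ℕ.+ m ≡ h → N m m ≈ topWeight m
  N-top zero    eq = N-zero 0
  N-top (suc j) eq = trans (x+0≈[0+0]+y
      (M-vanishes j (suc j) v (ℕ.n<1+n j))
      (N-vanishes j (suc (suc j)) (≡.trans (ℕ.+-suc j (suc j)) eq) (ℕ.m≤n⇒m≤1+n (ℕ.n≤1+n j)) (ℕ.n<1+n j))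
      (trans (M-diag (ℕ.≤-reflexive eq) (suc j)) (M-vanishes j (suc j) v (ℕ.n<1+n j)))
      (N-step-coeff eq (suc j)))
    (*-cong (reflexive (≡.cong w (≡.sym eq))) (M-top j (ℕ.≤-trans (ℕ.n≤1+n _) (ℕ.≤-reflexive eq))))
    where
    v : Valid j (suc j)
    v = ℕ.n≤1+n j , ℕ.≤-trans (ℕ.n≤1+n _) (ℕ.≤-reflexive eq)

-- The specialisation q = 1

nC0≡1 : ∀ n → n C 0 ≡ 1
nC0≡1 n = ≡.trans (nCk≡nC[n∸k] {n = n} z≤n) (nCn≡1 n)

sum-applyUpTo-cong : ∀ {f g : ℕ → ℕ} → (∀ k → f k ≡ g k) → ∀ n → sumℕ (applyUpTo f n) ≡ sumℕ (applyUpTo g n)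
sum-applyUpTo-cong h zero    = ≡.refl
sum-applyUpTo-cong h (suc n) = ≡.cong₂ ℕ._+_ (h 0) (sum-applyUpTo-cong (h ∘ suc) n)

sum-applyUpTo-+ : ∀ (f g : ℕ → ℕ) n →
  sumℕ (applyUpTo (λ k → f k ℕ.+ g k) n) ≡ sumℕ (applyUpTo f n) ℕ.+ sumℕ (applyUpTo g n)
sum-applyUpTo-+ f g zero    = ≡.refl
sum-applyUpTo-+ f g (suc n) = ≡.trans (≡.cong (f 0 ℕ.+ g 0 ℕ.+_) (sum-applyUpTo-+ (f ∘ suc) (g ∘ suc) n))
  (interchange (f 0) (g 0) _ _)
  where open import Algebra.Properties.CommutativeSemigroup ℕ.+-commutativeSemigroup using (interchange)

sum-applyUpTo-∷ʳ : ∀ (f : ℕ → ℕ) n → sumℕ (applyUpTo f (suc n)) ≡ sumℕ (applyUpTo f n) ℕ.+ f n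
sum-applyUpTo-∷ʳ f n = ≡.trans (≡.cong sumℕ (≡.sym (applyUpTo-∷ʳ f n)))
  (≡.trans (sumℕ-++ (applyUpTo f n) (f n ∷ [])) (≡.cong (sumℕ (applyUpTo f n) ℕ.+_) (ℕ.+-identityʳ (f n))))

-- The offset `s` carries the induction: Pascal's rule in the first factor splits the sum into those
-- with offsets `suc s` and `s`.
vandermonde : ∀ m n s → sumℕ (applyUpTo (λ k → (m C k) ℕ.* (n C (k ℕ.+ s))) (suc m)) ≡ (m ℕ.+ n) C (m ℕ.+ s)
vandermonde zero    n s = ≡.trans (ℕ.+-identityʳ _) (ℕ.+-identityʳ _)
vandermonde (suc m) n s = begin
  (suc m C 0) ℕ.* (n C s) ℕ.+ sumℕ (applyUpTo (λ k → (suc m C suc k) ℕ.* (n C (suc k ℕ.+ s))) (suc m))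
    ≡⟨ ≡.cong₂ ℕ._+_ (≡.cong (ℕ._* (n C s)) (≡.trans (nC0≡1 (suc m)) (≡.sym (nC0≡1 m))))
         (≡.trans (sum-applyUpTo-cong split (suc m)) (sum-applyUpTo-+ (λ k → (m C k) ℕ.* (n C (k ℕ.+ suc s))) (f ∘ suc) (suc m))) ⟩
  f 0 ℕ.+ (sumℕ (applyUpTo (λ k → (m C k) ℕ.* (n C (k ℕ.+ suc s))) (suc m)) ℕ.+ sumℕ (applyUpTo (f ∘ suc) (suc m)))
    ≡⟨ x∙yz≈y∙xz (f 0) (sumℕ (applyUpTo (λ k → (m C k) ℕ.* (n C (k ℕ.+ suc s))) (suc m))) (sumℕ (applyUpTo (f ∘ suc) (suc m))) ⟩
  sumℕ (applyUpTo (λ k → (m C k) ℕ.* (n C (k ℕ.+ suc s))) (suc m)) ℕ.+ sumℕ (applyUpTo f (suc (suc m)))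
    -- The second sum runs one index past `m`; its last term contains `m C suc m`, which is 0.
    ≡⟨ ≡.cong₂ ℕ._+_ (vandermonde m n (suc s)) (≡.trans (sum-applyUpTo-∷ʳ f (suc m))
         (≡.trans (≡.cong₂ ℕ._+_ (vandermonde m n s) (≡.cong (ℕ._* (n C (suc m ℕ.+ s))) (k>n⇒nCk≡0 (ℕ.n<1+n m)))) (ℕ.+-identityʳ _))) ⟩
  (m ℕ.+ n) C (m ℕ.+ suc s) ℕ.+ (m ℕ.+ n) C (m ℕ.+ s)
    ≡⟨ ≡.trans (ℕ.+-comm ((m ℕ.+ n) C (m ℕ.+ suc s)) _) (≡.cong (λ k → (m ℕ.+ n) C (m ℕ.+ s) ℕ.+ (m ℕ.+ n) C k) (ℕ.+-suc m s)) ⟩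
  (m ℕ.+ n) C (m ℕ.+ s) ℕ.+ (m ℕ.+ n) C suc (m ℕ.+ s)
    ≡⟨ nCk+nC[k+1]≡[n+1]C[k+1] (m ℕ.+ n) (m ℕ.+ s) ⟩
  suc (m ℕ.+ n) C suc (m ℕ.+ s) ∎
  where
  open ≡.≡-Reasoning
  open import Algebra.Properties.CommutativeSemigroup ℕ.+-commutativeSemigroup using (x∙yz≈y∙xz)
  f : ℕ → ℕ
  f k = (m C k) ℕ.* (n C (k ℕ.+ s))
  split : ∀ k → (suc m C suc k) ℕ.* (n C (suc k ℕ.+ s)) ≡ (m C k) ℕ.* (n C (k ℕ.+ suc s)) ℕ.+ f (suc k)
  split k = ≡.trans (≡.cong (ℕ._* (n C (suc k ℕ.+ s))) (≡.sym (nCk+nC[k+1]≡[n+1]C[k+1] m k)))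
    (≡.trans (ℕ.*-distribʳ-+ (n C (suc k ℕ.+ s)) (m C k) (m C suc k))
      (≡.cong (λ j → (m C k) ℕ.* (n C j) ℕ.+ f (suc k)) (≡.sym (ℕ.+-suc k s))))

-- Opaque, because _C_ unfolds into a conditional and a quotient of factorials.
opaque
  binom : ℕ → ℕ → ℤ
  binom n k = + (n C k)

  binom-C : ∀ n k → binom n k ≡ + (n C k)
  binom-C n k = ≡.refl

  pascal : ∀ n k → binom (suc n) (suc k) ≡ binom n (suc k) ℤ.+ binom n k
  pascal n k = ≡.cong +_ (≡.trans (≡.sym (nCk+nC[k+1]≡[n+1]C[k+1] n k)) (ℕ.+-comm (n C k) (n C suc k)))

  binom-zero : ∀ n → binom n 0 ≡ 1ℤ
  binom-zero n = ≡.cong +_ (nC0≡1 n)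

  binom-< : ∀ {n k} → n ℕ.< k → binom n k ≡ 0ℤ
  binom-< n<k = ≡.cong +_ (k>n⇒nCk≡0 n<k)

binom⁻ : ℕ → ℕ → ℤ
binom⁻ n zero    = 0ℤ
binom⁻ n (suc k) = binom n k

-- Since `binom⁻ n (suc k)` is `binom n k`, this is Pascal's rule for C(n + 1 , k) without a case
-- distinction at k = 0.
pascal⁻ : ∀ n k → binom⁻ (suc n) (suc k) ≡ binom⁻ n (suc k) ℤ.+ binom⁻ n k
pascal⁻ n zero    = ≡.trans (binom-zero (suc n)) (≡.trans (≡.sym (binom-zero n)) (≡.sym (ℤ.+-identityʳ (binom n 0))))
pascal⁻ n (suc k) = pascal n k

-- The number of lattice paths from (0 , 0) to (i , c) inside i ≤ c with k turns
-- from an i-step to a c-step, by the reflection principle for turns.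
turns : ℕ → ℕ → ℕ → ℤ
turns i c k = binom i k ℤ.* binom c k ℤ.- binom (suc i) (suc k) ℤ.* binom⁻ (c ℕ.∸ 1) k

turns-zero : ∀ i c → turns i c 0 ≡ 1ℤ
turns-zero i c rewrite binom-zero i | binom-zero c | ℤ.*-zeroʳ (binom (suc i) 1) = ≡.refl

turns-edge : ∀ c k → turns 0 c (suc k) ≡ 0ℤ
turns-edge c k rewrite binom-< {0} {suc k} (s≤s z≤n) | binom-< {1} {suc (suc k)} (s≤s (s≤s z≤n)) = ≡.refl

turns-diag : ∀ i k → turns (suc i) (suc i) k ≡ turns i (suc i) k
turns-diag i zero = ≡.trans (turns-zero (suc i) (suc i)) (≡.sym (turns-zero i (suc i)))
turns-diag i (suc k)
  rewrite pascal (suc i) (suc k) | pascal i k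
  = identity (binom i (suc k)) (binom i k) (binom (suc i) (suc (suc k)))
  where
  identity : ∀ p₁ p₀ s → (p₁ ℤ.+ p₀) ℤ.* (p₁ ℤ.+ p₀) ℤ.- (s ℤ.+ (p₁ ℤ.+ p₀)) ℤ.* p₀ ≡ p₁ ℤ.* (p₁ ℤ.+ p₀) ℤ.- s ℤ.* p₀
  identity = ℤ-Solver.solve-∀

shift : (ℕ → ℤ) → ℕ → ℤ
shift f zero    = 0ℤ
shift f (suc k) = f k

shift-cong : ∀ {f g} → (∀ k → f k ≡ g k) → ∀ k → shift f k ≡ shift g k
shift-cong h zero    = ≡.refl
shift-cong h (suc k) = h k

turns-step : ∀ {i c} → i ℕ.< c → ∀ k → turns (suc i) (suc c) k ℤ.+ turns i c k ≡
  (turns i (suc c) k ℤ.+ turns (suc i) c k) ℤ.+ shift (turns i c) k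
turns-step {i} {c} _ zero
  rewrite turns-zero (suc i) (suc c) | turns-zero i c | turns-zero i (suc c) | turns-zero (suc i) c = ≡.refl
-- `i < c` makes `c` a successor, so Pascal's rule also applies to the reflected factor with its
-- `c ∸ 1`. What remains is a polynomial identity in the binomials.
turns-step {i} {suc c} _ (suc k)
  rewrite pascal (suc i) (suc k) | pascal i k | pascal (suc c) k | pascal⁻ c k
  = identity (binom i (suc k)) (binom i k) (binom (suc c) (suc k)) (binom c k ℤ.+ binom⁻ c k)
             (binom (suc i) (suc (suc k))) (binom c k) (binom⁻ c k)
  where
  identity : ∀ p₁ p₀ r₁ r₀ s u₁ u₀ →
    ((p₁ ℤ.+ p₀) ℤ.* (r₁ ℤ.+ r₀) ℤ.- (s ℤ.+ (p₁ ℤ.+ p₀)) ℤ.* (u₁ ℤ.+ u₀)) ℤ.+ (p₁ ℤ.* r₁ ℤ.- s ℤ.* u₁) ≡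
    ((p₁ ℤ.* (r₁ ℤ.+ r₀) ℤ.- s ℤ.* (u₁ ℤ.+ u₀)) ℤ.+ ((p₁ ℤ.+ p₀) ℤ.* r₁ ℤ.- (s ℤ.+ (p₁ ℤ.+ p₀)) ℤ.* u₁))
      ℤ.+ (p₀ ℤ.* r₀ ℤ.- (p₁ ℤ.+ p₀) ℤ.* u₀)
  identity = ℤ-Solver.solve-∀

-- The recurrence `N-step-coeff` at q = 1, with the products of binomials in the place of `N`.
products-step : ∀ {j c} → j ℕ.< c → ∀ k → binom (suc j) k ℤ.* binom c k ℤ.+ turns j c k ≡
  (binom j k ℤ.* binom (suc c) k ℤ.+ turns (suc j) c k) ℤ.+ shift (turns j c) k
products-step {j} {c} _ zero
  rewrite turns-zero j c | turns-zero (suc j) c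
        | binom-zero (suc j) | binom-zero j | binom-zero (suc c) | binom-zero c = ≡.refl
products-step {j} {suc c} _ (suc k)
  rewrite pascal (suc j) (suc k) | pascal j k | pascal (suc c) k | pascal⁻ c k
  = identity (binom j (suc k)) (binom j k) (binom (suc c) (suc k)) (binom (suc j) (suc (suc k))) (binom c k) (binom⁻ c k)
  where
  identity : ∀ p₁ p₀ r s u₁ u₀ →
    (p₁ ℤ.+ p₀) ℤ.* r ℤ.+ (p₁ ℤ.* r ℤ.- s ℤ.* u₁) ≡
    (p₁ ℤ.* (r ℤ.+ (u₁ ℤ.+ u₀)) ℤ.+ ((p₁ ℤ.+ p₀) ℤ.* r ℤ.- (s ℤ.+ (p₁ ℤ.+ p₀)) ℤ.* u₁))
      ℤ.+ (p₀ ℤ.* (u₁ ℤ.+ u₀) ℤ.- (p₁ ℤ.+ p₀) ℤ.* u₀)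
  identity = ℤ-Solver.solve-∀

module Specialisation
  {c ℓ} (R : CommutativeRing c ℓ) (w : ℕ → CommutativeRing.Carrier R) (h : ℕ)
  (φ : CommutativeRing.Carrier R → ℤ)
  (φ-hom : SemiringMorphisms.IsSemiringHomomorphism (Semiring.rawSemiring (CommutativeRing.semiring R)) ℤ.+-*-rawSemiring φ)
  (φ-w : ∀ n → φ (w n) ≡ 1ℤ)
  where
  open CommutativeRing R using (_≈_; _+_; _*_)
  open SemiringMorphisms.IsSemiringHomomorphism φ-hom using (⟦⟧-cong; +-homo; *-homo; 0#-homo; 1#-homo)
  open PowerSeries R using (δ; _t∙_)
  open Chains R w h
  open import Algebra.Properties.Group (CommutativeRing.+-group ℤ.+-*-commutativeRing) using (∙-cancelʳ)
  open ≡.≡-Reasoning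

  φ-t∙ : ∀ n f k → φ ((w n t∙ f) k) ≡ shift (φ ∘ f) k
  φ-t∙ n f zero    = 0#-homo
  φ-t∙ n f (suc k) = ≡.trans (*-homo (w n) (f k)) (≡.trans (≡.cong (ℤ._* φ (f k)) (φ-w n)) (ℤ.*-identityˡ (φ (f k))))

  -- The image of the unknown `a` and the candidate `y` satisfy the same additive recurrence, and
  -- the common summand `β` cancels in ℤ.
  φ-step : ∀ n f k {a b c d β γ γ′ y} {ε : ℕ → ℤ} → a + b ≈ (c + d) + (w n t∙ f) k →
           φ b ≡ β → φ c ≡ γ → φ d ≡ γ′ → (∀ k → φ (f k) ≡ ε k) →
           y ℤ.+ β ≡ (γ ℤ.+ γ′) ℤ.+ shift ε k → φ a ≡ y
  φ-step n f k {a} {b} {c} {d} {y = y} {ε} eq ≡.refl ≡.refl ≡.refl hf hy = ∙-cancelʳ (φ b) (φ a) y (begin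
    φ a ℤ.+ φ b                                ≡⟨ +-homo a b ⟨
    φ (a + b)                                  ≡⟨ ⟦⟧-cong eq ⟩
    φ ((c + d) + (w n t∙ f) k)                 ≡⟨ +-homo (c + d) ((w n t∙ f) k) ⟩
    φ (c + d) ℤ.+ φ ((w n t∙ f) k)             ≡⟨ ≡.cong₂ ℤ._+_ (+-homo c d) (≡.trans (φ-t∙ n f k) (shift-cong hf k)) ⟩
    (φ c ℤ.+ φ d) ℤ.+ shift ε k                ≡⟨ hy ⟨
    y ℤ.+ φ b ∎)

  φ-δ : ∀ (x : ℕ → ℤ) → x 0 ≡ 1ℤ → (∀ k → x (suc k) ≡ 0ℤ) → ∀ k → φ (δ k) ≡ x k
  φ-δ x x0 xs zero    = ≡.trans 1#-homo (≡.sym x0)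
  φ-δ x x0 xs (suc k) = ≡.trans 0#-homo (≡.sym (xs k))

  φ-M : ∀ i c → Valid i c → ∀ k → φ (M i c k) ≡ turns i c k
  φ-M zero    c (_ , c≤h) k = ≡.trans (⟦⟧-cong (M-zero c c≤h k)) (φ-δ (turns 0 c) (turns-zero 0 c) (turns-edge c) k)
  φ-M (suc i) (suc c) (s≤s i≤c , ≤h) k with ℕ.m≤n⇒m<n∨m≡n i≤c
  ... | inj₂ ≡.refl = ≡.trans (⟦⟧-cong (M-diag ≤h k))
    (≡.trans (φ-M i (suc i) (ℕ.n≤1+n i , ℕ.≤-trans (ℕ.n≤1+n _) ≤h) k) (≡.sym (turns-diag i k)))
  ... | inj₁ i<c = let v , v₀₁ , v₁₀ = valid-pred i<c ≤h in
    φ-step (suc (i ℕ.+ c)) (M i c) k (M-step-coeff (s≤s i≤c , ≤h) k)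
      (φ-M i c v k) (φ-M i (suc c) v₀₁ k) (φ-M (suc i) c v₁₀ k) (φ-M i c v) (turns-step i<c k)

  φ-N : ∀ j c → j ℕ.+ c ≡ h → j ℕ.≤ c → ∀ k → φ (N j k) ≡ binom j k ℤ.* binom c k
  φ-N zero    c eq j≤c k = ≡.trans (⟦⟧-cong (N-zero k))
    (φ-δ (λ k → binom 0 k ℤ.* binom c k) (≡.cong₂ ℤ._*_ (binom-zero 0) (binom-zero c))
         (λ k → ≡.cong (ℤ._* binom c (suc k)) (binom-< (s≤s z≤n))) k)
  φ-N (suc j) c eq j<c k =
    φ-step h (M j c) k (N-step-coeff eq k)
      (φ-M j c v k)
      (φ-N j (suc c) (≡.trans (ℕ.+-suc j c) eq) (ℕ.m≤n⇒m≤1+n (ℕ.<⇒≤ j<c)) k)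
      (φ-M (suc j) c (j<c , ℕ.≤-reflexive eq) k)
      (φ-M j c v) (products-step j<c k)
    where
    v : Valid j c
    v = ℕ.<⇒≤ j<c , ℕ.≤-trans (ℕ.n≤1+n _) (ℕ.≤-reflexive eq)

-- Coordinates on the root poset

step-≤ : ∀ {r} (i k : Fin r) → i Fin.≤ k → step i k ≡ 1
step-≤ zero    k       _         = ≡.refl
step-≤ (suc i) (suc k) (s≤s i≤k) = step-≤ i k i≤k

step-> : ∀ {r} (i k : Fin r) → k Fin.< i → step i k ≡ 0
step-> (suc i) zero    _         = ≡.refl
step-> (suc i) (suc k) (s≤s k<i) = step-> i k k<i

step≤1 : ∀ {r} (i k : Fin r) → step i k ℕ.≤ 1
step≤1 zero    k       = ≤-refl
step≤1 (suc i) zero    = z≤n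
step≤1 (suc i) (suc k) = step≤1 i k

step-mono : ∀ {r} {i j : Fin r} → i Fin.≤ j → ∀ k → step j k ℕ.≤ step i k
step-mono {i = zero}  {j}     i≤j       k       = step≤1 j k
step-mono {i = suc i} {suc j} i≤j       zero    = z≤n
step-mono {i = suc i} {suc j} (s≤s i≤j) (suc k) = step-mono i≤j k

∑ℕ : ∀ {n} → (Fin n → ℕ) → ℕ
∑ℕ = sum ℕ.+-0-commutativeMonoid

∑-step : ∀ {r} (i : Fin r) → ∑ℕ (step i) ℕ.+ toℕ i ≡ r
∑-step zero    = ≡.trans (ℕ.+-identityʳ _) (ones _)
  where
  ones : ∀ n → ∑ℕ {n} (λ _ → 1) ≡ n
  ones zero    = ≡.refl
  ones (suc n) = ≡.cong suc (ones n)
∑-step (suc i) = ≡.trans (ℕ.+-suc _ _) (≡.cong suc (∑-step i))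

infix 4 _≤ᶜ_
-- A form of `≼` in which no combination has to be exhibited; the equivalence rests on the
-- uniqueness of `simpleCoeffs`.
_≤ᶜ_ : ∀ {r} → PosRoot r → PosRoot r → Set
α ≤ᶜ β = ∀ k → simpleCoeffs α k ℕ.≤ simpleCoeffs β k

combination-cong : ∀ {r} {c d : Fin r → ℕ} → c ≡.≗ d → combination c ≡.≗ combination d
combination-cong c≗d k = sum-cong (λ i → ≡.cong (λ n → + n ℤ.* simpleRoot i k) (c≗d i))

≼⇒≤ᶜ : ∀ {r} (α β : PosRoot r) → α ≼ β → α ≤ᶜ β
≼⇒≤ᶜ α β (c , β-α≗c) k = ≡.subst (simpleCoeffs α k ℕ.≤_) (simpleCoeffs-unique β {λ i → simpleCoeffs α i ℕ.+ c i} β≗ k) (m≤m+n _ _)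
  where
  add-back : ∀ x y → y ≡ x ℤ.+ (y ℤ.- x)
  add-back = ℤ-Solver.solve-∀
  β≗ : ⟦ β ⟧ ≡.≗ combination (λ i → simpleCoeffs α i ℕ.+ c i)
  β≗ k = ≡.trans (add-back (⟦ α ⟧ k) (⟦ β ⟧ k))
    (≡.trans (≡.cong₂ ℤ._+_ (simpleCoeffs-correct α k) (β-α≗c k)) (≡.sym (combination-+ (simpleCoeffs α) c k)))

≤ᶜ⇒≼ : ∀ {r} {α β : PosRoot r} → α ≤ᶜ β → α ≼ β
≤ᶜ⇒≼ {α = α} {β} α≤β = c , λ k → ≡.trans (≡.cong (ℤ._- ⟦ α ⟧ k) (β≗ k)) (cancel (⟦ α ⟧ k) (combination c k))
  where
  c : Fin _ → ℕ
  c k = simpleCoeffs β k ℕ.∸ simpleCoeffs α k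
  cancel : ∀ x y → (x ℤ.+ y) ℤ.- x ≡ y
  cancel = ℤ-Solver.solve-∀
  β≗ : ∀ k → ⟦ β ⟧ k ≡ ⟦ α ⟧ k ℤ.+ combination c k
  β≗ k = ≡.trans (simpleCoeffs-correct β k)
    (≡.trans (combination-cong (λ i → ≡.sym (ℕ.m+[n∸m]≡n (α≤β i))) k)
    (≡.trans (combination-+ (simpleCoeffs α) c k) (≡.cong (ℤ._+ combination c k) (≡.sym (simpleCoeffs-correct α k)))))

module _ {m : ℕ} where
  private r = suc m

  firstIndex : PosRoot r → Fin r
  firstIndex (minus i _ _) = i
  firstIndex (short i)     = i
  firstIndex (plus i _ _)  = i

  -- Indices are 0-based; the image is the set of all (i , c) with i ≤ c and
  -- i + c ≤ 2m, and α ≼ β reverses to the componentwise order.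
  coordI coordC : PosRoot r → ℕ
  coordI α = toℕ (firstIndex α)
  coordC (minus _ j _) = suc (m ℕ.+ m) ℕ.∸ toℕ j
  coordC (short _)     = m
  coordC (plus _ j _)  = ℕ.pred (toℕ j)

  private
    j≤m : (j : Fin r) → toℕ j ℕ.≤ m
    j≤m = toℕ≤pred[n]

    ≤2m+1 : (j : Fin r) → toℕ j ℕ.≤ suc (m ℕ.+ m)
    ≤2m+1 j = ≤-trans (j≤m j) (≤-trans (m≤m+n m m) (ℕ.n≤1+n _))

    m<coordC-minus : (j : Fin r) → m ℕ.< suc (m ℕ.+ m) ℕ.∸ toℕ j
    m<coordC-minus j = ℕ.≤-trans (ℕ.≤-reflexive (≡.sym (ℕ.m+n∸n≡m (suc m) m))) (ℕ.∸-monoʳ-≤ (suc (m ℕ.+ m)) (j≤m j))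

    pred≤m : (j : Fin r) → ℕ.pred (toℕ j) ℕ.≤ m
    pred≤m j = ≤-trans ℕ.pred[n]≤n (j≤m j)

    positive : ∀ {i j : Fin r} → i Fin.< j → 0 ℕ.< toℕ j
    positive = ℕ.≤-<-trans z≤n

    suc-pred : ∀ {n} → 0 ℕ.< n → suc (ℕ.pred n) ≡ n
    suc-pred (s≤s _) = ≡.refl

    pred<m : ∀ {i j : Fin r} → i Fin.< j → ℕ.pred (toℕ j) ℕ.< m
    pred<m {j = j} i<j = ≤-trans (≤-reflexive (suc-pred (positive i<j))) (j≤m j)

  -- The second coordinate is below, equal to or above `m` for plus, short and minus roots; this
  -- excludes the three pairs of kinds that run against the order.
  ≤⇒≤ᶜ : ∀ {α β} → coordI β ℕ.≤ coordI α → coordC β ℕ.≤ coordC α → α ≤ᶜ β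
  ≤⇒≤ᶜ {minus i j _} {minus i′ j′ _} i′≤i c′≤c k = ℕ.∸-mono (step-mono i′≤i k)
    (step-mono {i = j} {j′} (ℕ.≮⇒≥ (λ j′<j → ℕ.<⇒≱ (ℕ.∸-monoʳ-< j′<j (≤2m+1 j)) c′≤c)) k)
  ≤⇒≤ᶜ {minus i j _} {short i′}      i′≤i _    k = ≤-trans (ℕ.m∸n≤m _ (step j k)) (step-mono i′≤i k)
  ≤⇒≤ᶜ {minus i j _} {plus i′ j′ _}  i′≤i _    k =
    ≤-trans (ℕ.m∸n≤m _ (step j k)) (≤-trans (step-mono i′≤i k) (m≤m+n _ _))
  ≤⇒≤ᶜ {short _}     {minus _ j′ _}  _    c′≤c = contradiction c′≤c (ℕ.<⇒≱ (m<coordC-minus j′))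
  ≤⇒≤ᶜ {short i}     {short i′}      i′≤i _    k = step-mono i′≤i k
  ≤⇒≤ᶜ {short i}     {plus i′ j′ _}  i′≤i _    k = ≤-trans (step-mono i′≤i k) (m≤m+n _ _)
  ≤⇒≤ᶜ {plus _ j _}  {minus _ j′ _}  _    c′≤c =
    contradiction (≤-trans c′≤c (pred≤m j)) (ℕ.<⇒≱ (m<coordC-minus j′))
  ≤⇒≤ᶜ {plus _ j i<j} {short _}      _    c′≤c = contradiction c′≤c (ℕ.<⇒≱ (pred<m i<j))
  ≤⇒≤ᶜ {plus i j i<j} {plus i′ j′ i′<j′} i′≤i c′≤c k = ℕ.+-mono-≤ (step-mono i′≤i k) (step-mono j′≤j k)
    where
    j′≤j : toℕ j′ ℕ.≤ toℕ j
    j′≤j = ≡.subst₂ ℕ._≤_ (suc-pred (positive i′<j′)) (suc-pred (positive i<j)) (s≤s c′≤c)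

  coeff-firstIndex : (α : PosRoot r) → simpleCoeffs α (firstIndex α) ≡ 1
  coeff-firstIndex (minus i j i<j) = ≡.cong₂ ℕ._∸_ (step-≤ i i ≤-refl) (step-> j i i<j)
  coeff-firstIndex (short i)       = step-≤ i i ≤-refl
  coeff-firstIndex (plus i j i<j)  = ≡.cong₂ ℕ._+_ (step-≤ i i ≤-refl) (step-> j i i<j)

  coeff-before : (α : PosRoot r) → ∀ k → k Fin.< firstIndex α → simpleCoeffs α k ≡ 0
  coeff-before (minus i j i<j) k k<i = ≡.cong₂ ℕ._∸_ (step-> i k k<i) (step-> j k (ℕ.<-trans k<i i<j))
  coeff-before (short i)       k k<i = step-> i k k<i
  coeff-before (plus i j i<j)  k k<i = ≡.cong₂ ℕ._+_ (step-> i k k<i) (step-> j k (ℕ.<-trans k<i i<j))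

  -- `firstIndex` is the position of the first nonzero coefficient.
  ≤ᶜ⇒coordI≤ : ∀ {α β} → α ≤ᶜ β → coordI β ℕ.≤ coordI α
  ≤ᶜ⇒coordI≤ {α} {β} α≤β = ℕ.≮⇒≥ λ i<i′ →
    ℕ.<⇒≱ (s≤s z≤n) (≡.subst₂ ℕ._≤_ (coeff-firstIndex α) (coeff-before β (firstIndex α) i<i′) (α≤β (firstIndex α)))

  private
    last : Fin r
    last = fromℕ m

    step-last : ∀ i → step i last ≡ 1
    step-last i = step-≤ i last (Fin.≤fromℕ i)

  -- The coefficient of the last simple root is 0, 1 or 2 for minus, short and plus roots, which
  -- settles the pairs of kinds against the order. Equal kinds are compared at a single index.
  ≤ᶜ⇒coordC≤ : ∀ {α β} → α ≤ᶜ β → coordC β ℕ.≤ coordC α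
  ≤ᶜ⇒coordC≤ {minus i j i<j} {minus i′ j′ _} α≤β = ℕ.∸-monoʳ-≤ {toℕ j} {toℕ j′} (suc (m ℕ.+ m)) (ℕ.≮⇒≥ (go j i<j α≤β))
    where
    go : ∀ j (i<j : i Fin.< j) → (∀ k → step i k ℕ.∸ step j k ℕ.≤ step i′ k ℕ.∸ step j′ k) → ¬ (j′ Fin.< j)
    -- `k` is the index just before the second index of α: the last one where α has coefficient 1,
    -- while β already has 0 there.
    go (suc j) (s≤s i≤j) α≤β (s≤s j′≤j) = ℕ.<⇒≱ (s≤s z≤n) (≡.subst₂ ℕ._≤_
      (≡.cong₂ ℕ._∸_ (step-≤ i k (≤-trans i≤j k≥)) (step-> (suc j) k (s≤s (≤-reflexive (toℕ-inject₁ j)))))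
      (ℕ.m≤n⇒m∸n≡0 (≤-trans (step≤1 i′ k) (≤-reflexive (≡.sym (step-≤ j′ k (≤-trans j′≤j k≥))))))
      (α≤β k))
      where
      k = inject₁ j
      k≥ : toℕ j ℕ.≤ toℕ k
      k≥ = ≤-reflexive (≡.sym (toℕ-inject₁ j))
  ≤ᶜ⇒coordC≤ {minus i j _} {short _}      _ = ℕ.<⇒≤ (m<coordC-minus j)
  ≤ᶜ⇒coordC≤ {minus i j _} {plus _ j′ _}  _ = ≤-trans (pred≤m j′) (ℕ.<⇒≤ (m<coordC-minus j))
  ≤ᶜ⇒coordC≤ {short i}     {minus i′ j′ _} α≤β = contradiction
    (≡.subst₂ ℕ._≤_ (step-last i) (≡.cong₂ ℕ._∸_ (step-last i′) (step-last j′)) (α≤β last)) λ ()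
  ≤ᶜ⇒coordC≤ {short _}     {short _}      _ = ≤-refl
  ≤ᶜ⇒coordC≤ {short _}     {plus _ j′ _}  _ = pred≤m j′
  ≤ᶜ⇒coordC≤ {plus i j _}  {minus i′ j′ _} α≤β = contradiction
    (≡.subst₂ ℕ._≤_ (≡.cong₂ ℕ._+_ (step-last i) (step-last j)) (≡.cong₂ ℕ._∸_ (step-last i′) (step-last j′)) (α≤β last)) λ ()
  ≤ᶜ⇒coordC≤ {plus i j _}  {short i′}     α≤β = contradiction
    (≡.subst₂ ℕ._≤_ (≡.cong₂ ℕ._+_ (step-last i) (step-last j)) (step-last i′) (α≤β last)) λ { (s≤s ()) }
  -- At index `j` the coefficient of α is 2, but that of β would be at most 1 if `j < j′`.
  ≤ᶜ⇒coordC≤ {plus i j i<j} {plus i′ j′ _} α≤β = ℕ.pred-mono-≤ (ℕ.≮⇒≥ λ j<j′ →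
    ℕ.<⇒≱ (s≤s (ℕ.+-mono-≤ (step≤1 i′ j) (≤-reflexive (step-> j′ j j<j′))))
      (≡.subst (ℕ._≤ step i′ j ℕ.+ step j′ j) (≡.cong₂ ℕ._+_ (step-≤ i j (ℕ.<⇒≤ i<j)) (step-≤ j j ≤-refl)) (α≤β j)))

  ≼⇒≤ : ∀ {α β} → α ≼ β → coordI β ℕ.≤ coordI α × coordC β ℕ.≤ coordC α
  ≼⇒≤ {α} {β} α≼β = ≤ᶜ⇒coordI≤ {α} {β} (≼⇒≤ᶜ α β α≼β) , ≤ᶜ⇒coordC≤ {α} {β} (≼⇒≤ᶜ α β α≼β)

  ≤⇒≼ : ∀ {α β} → coordI β ℕ.≤ coordI α → coordC β ℕ.≤ coordC α → α ≼ β
  ≤⇒≼ {α} {β} i′≤i c′≤c = ≤ᶜ⇒≼ {α = α} {β} (≤⇒≤ᶜ {α} {β} i′≤i c′≤c)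

  -- Coordinates determine the order, so antisymmetry replaces a comparison of cases.
  coords-injective : ∀ {α β} → coordI α ≡ coordI β → coordC α ≡ coordC β → α ≡ β
  coords-injective {α} {β} p q = ≼-antisym
    (≤⇒≼ {α} {β} (≤-reflexive (≡.sym p)) (≤-reflexive (≡.sym q)))
    (≤⇒≼ {β} {α} (≤-reflexive p) (≤-reflexive q))

  coordI≤coordC : (α : PosRoot r) → coordI α ℕ.≤ coordC α
  coordI≤coordC (minus i j _)  = ≤-trans (j≤m i) (ℕ.<⇒≤ (m<coordC-minus j))
  coordI≤coordC (short i)      = j≤m i
  coordI≤coordC (plus i j i<j) = s≤s⁻¹ (≤-trans i<j (≤-reflexive (≡.sym (suc-pred (positive i<j)))))

  ht-coords : (α : PosRoot r) → ht α ℕ.+ (coordI α ℕ.+ coordC α) ≡ suc (m ℕ.+ m)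
  ht-coords (minus i j i<j) = ≡.trans (≡.sym (ℕ.+-assoc (ht (minus i j i<j)) (toℕ i) _))
    (≡.trans (≡.cong (ℕ._+ coordC (minus i j i<j)) ht+i≡j) (ℕ.m+[n∸m]≡n (≤2m+1 j)))
    where
    open ≡.≡-Reasoning
    ht+i≡j : ht (minus i j i<j) ℕ.+ toℕ i ≡ toℕ j
    -- Adding `∑ℕ (step j)` undoes the truncated subtraction in the coefficients of a minus root.
    ht+i≡j = ℕ.+-cancelˡ-≡ (∑ℕ (step j)) _ _ (begin
      ∑ℕ (step j) ℕ.+ (ht (minus i j i<j) ℕ.+ toℕ i)    ≡⟨ ℕ.+-assoc (∑ℕ (step j)) _ _ ⟨
      ∑ℕ (step j) ℕ.+ ht (minus i j i<j) ℕ.+ toℕ i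
        ≡⟨ ≡.cong (ℕ._+ toℕ i) (∑-distrib-+ ℕ.+-0-commutativeMonoid (step j) (λ k → step i k ℕ.∸ step j k)) ⟨
      ∑ℕ (λ k → step j k ℕ.+ (step i k ℕ.∸ step j k)) ℕ.+ toℕ i
        ≡⟨ ≡.cong (ℕ._+ toℕ i) (sum-cong-≗ ℕ.+-0-commutativeMonoid (λ k → ℕ.m+[n∸m]≡n (step-anti i<j k))) ⟩
      ∑ℕ (step i) ℕ.+ toℕ i                             ≡⟨ ≡.trans (∑-step i) (≡.sym (∑-step j)) ⟩
      ∑ℕ (step j) ℕ.+ toℕ j ∎)
  ht-coords (short i) = ≡.trans (≡.sym (ℕ.+-assoc (∑ℕ (step i)) (toℕ i) m)) (≡.cong (ℕ._+ m) (∑-step i))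
  ht-coords (plus i j i<j) = ℕ.suc-injective (begin
    suc (ht (plus i j i<j) ℕ.+ (toℕ i ℕ.+ c))
      ≡⟨ ≡.cong (λ n → suc (n ℕ.+ (toℕ i ℕ.+ c))) (∑-distrib-+ ℕ.+-0-commutativeMonoid (step i) (step j)) ⟩
    suc (∑ℕ (step i) ℕ.+ ∑ℕ (step j) ℕ.+ (toℕ i ℕ.+ c))   ≡⟨ ≡.cong suc (interchange (∑ℕ (step i)) _ _ _) ⟩
    suc (∑ℕ (step i) ℕ.+ toℕ i ℕ.+ (∑ℕ (step j) ℕ.+ c))   ≡⟨ ℕ.+-suc _ _ ⟨
    ∑ℕ (step i) ℕ.+ toℕ i ℕ.+ suc (∑ℕ (step j) ℕ.+ c)
      ≡⟨ ≡.cong (∑ℕ (step i) ℕ.+ toℕ i ℕ.+_) (≡.trans (≡.sym (ℕ.+-suc _ c)) (≡.cong (∑ℕ (step j) ℕ.+_) (suc-pred (positive i<j)))) ⟩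
    ∑ℕ (step i) ℕ.+ toℕ i ℕ.+ (∑ℕ (step j) ℕ.+ toℕ j)     ≡⟨ ≡.cong₂ ℕ._+_ (∑-step i) (∑-step j) ⟩
    suc m ℕ.+ suc m                                       ≡⟨ ≡.cong suc (ℕ.+-suc m m) ⟩
    suc (suc (m ℕ.+ m)) ∎)
    where
    open ≡.≡-Reasoning
    open import Algebra.Properties.CommutativeSemigroup ℕ.+-commutativeSemigroup using (interchange)
    c = ℕ.pred (toℕ j)

  rk-coords : (α : PosRoot r) → rk α ℕ.+ (coordI α ℕ.+ coordC α) ≡ m ℕ.+ m
  rk-coords α = ℕ.suc-injective
    (≡.trans (≡.cong (ℕ._+ (coordI α ℕ.+ coordC α)) (suc-rk α)) (ht-coords α))

  coordI+coordC≤2m : (α : PosRoot r) → coordI α ℕ.+ coordC α ℕ.≤ m ℕ.+ m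
  coordI+coordC≤2m α = ≤-trans (m≤n+m _ (rk α)) (≤-reflexive (rk-coords α))

  root : ∀ {i c} → i ℕ.≤ c → i ℕ.+ c ℕ.≤ m ℕ.+ m → ∃ λ α → coordI α ≡ i × coordC α ≡ c
  root {i} {c} i≤c i+c≤2m with ℕ.<-cmp c m
  ... | tri< c<m _ _ = plus (fromℕ< i<r) (fromℕ< c+1<r) i<j , toℕ-fromℕ< i<r , ≡.cong ℕ.pred (toℕ-fromℕ< c+1<r)
    where
    i<r : i ℕ.< r
    i<r = s≤s (≤-trans i≤c (ℕ.<⇒≤ c<m))
    c+1<r : suc c ℕ.< r
    c+1<r = s≤s c<m
    i<j : fromℕ< i<r Fin.< fromℕ< c+1<r
    i<j = ≡.subst₂ ℕ._<_ (≡.sym (toℕ-fromℕ< i<r)) (≡.sym (toℕ-fromℕ< c+1<r)) (s≤s i≤c)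
  ... | tri≈ _ ≡.refl _ = short (fromℕ< (s≤s i≤c)) , toℕ-fromℕ< (s≤s i≤c) , ≡.refl
  ... | tri> _ _ m<c = minus (fromℕ< i<r) (fromℕ< j<r) i<j , toℕ-fromℕ< i<r ,
      ≡.trans (≡.cong (suc (m ℕ.+ m) ℕ.∸_) (toℕ-fromℕ< j<r)) (ℕ.m∸[m∸n]≡n (≤-trans (≤-trans (m≤n+m c i) i+c≤2m) (ℕ.n≤1+n _)))
    where
    j = suc (m ℕ.+ m) ℕ.∸ c
    j<r : j ℕ.< r
    j<r = s≤s (≤-trans (ℕ.∸-monoʳ-≤ (suc (m ℕ.+ m)) m<c) (≤-reflexive (ℕ.m+n∸m≡n m m)))
    i<j′ : i ℕ.< j
    i<j′ = ℕ.m+n≤o⇒m≤o∸n (suc i) (s≤s i+c≤2m)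
    i<r : i ℕ.< r
    i<r = ℕ.<-trans i<j′ j<r
    i<j : fromℕ< i<r Fin.< fromℕ< j<r
    i<j = ≡.subst₂ ℕ._<_ (≡.sym (toℕ-fromℕ< i<r)) (≡.sym (toℕ-fromℕ< j<r)) i<j′

-- Weak chains of positive roots

module WeakChains {c ℓ} (R : CommutativeRing c ℓ) (x : CommutativeRing.Carrier R)
                  (P : FinitePoset) (ρ : FinitePoset.Carrier P → ℕ) where
  open CommutativeRing R hiding (rawRing)
  open ListSum R
  open Exp semiring using (^-homo-*) renaming (_^_ to _↑_)
  open FinitePoset P using (_≤?_; elements) renaming (Carrier to Point)
  open Numerator P ρ using (tuples; weakChains)
  open SetoidReasoning setoid

  weight : ∀ {m} → Vec Point m → Carrier
  weight ys = x ↑ Vec.sum (Vec.map ρ ys)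

  A : ℕ → Carrier
  A m = ∑ (weakChains m) weight

  -- The weak chains y ≤ y₁ ≤ … ≤ yₘ, without the factor of y.
  chainsAbove : Point → ℕ → Carrier
  chainsAbove y m = ∑ (tuples m) λ ys → [ linked? _≤?_ (y ∷ ys) ] weight ys

  -- The condition on the head is `y ≤ z` in `chainsAbove-suc` and trivially true in `A-suc`.
  sum-by-head : ∀ {Q : Point → Set} (Q? : ∀ z → Dec (Q z)) m →
    ∑ elements (λ z → ∑ (tuples m) λ ys → [ Q? z ] [ linked? _≤?_ (z ∷ ys) ] weight (z ∷ ys))
      ≈ ∑ elements (λ z → [ Q? z ] ((x ↑ ρ z) * chainsAbove z m))
  sum-by-head Q? m = ∑-cong elements λ z → begin
    ∑ (tuples m) (λ ys → [ Q? z ] [ linked? _≤?_ (z ∷ ys) ] weight (z ∷ ys))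
      ≈⟨ []-∑ (Q? z) (tuples m) _ ⟨
    [ Q? z ] ∑ (tuples m) (λ ys → [ linked? _≤?_ (z ∷ ys) ] weight (z ∷ ys))
      ≈⟨ []-cong (Q? z) (∑-cong (tuples m) λ ys → trans
           ([]-cong (linked? _≤?_ (z ∷ ys)) (^-homo-* x (ρ z) (Vec.sum (Vec.map ρ ys))))
           (sym (*-[] (x ↑ ρ z) (linked? _≤?_ (z ∷ ys))))) ⟩
    [ Q? z ] ∑ (tuples m) (λ ys → (x ↑ ρ z) * ([ linked? _≤?_ (z ∷ ys) ] weight ys))
      ≈⟨ []-cong (Q? z) (*-∑ (x ↑ ρ z) (tuples m) _) ⟨
    [ Q? z ] ((x ↑ ρ z) * chainsAbove z m) ∎

  chainsAbove-suc : ∀ y m →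
    chainsAbove y (suc m) ≈ ∑ elements (λ z → [ y ≤? z ] ((x ↑ ρ z) * chainsAbove z m))
  chainsAbove-suc y m = begin
    chainsAbove y (suc m)
      ≈⟨ ∑-cartesianProductWith _∷_ elements (tuples m) _ ⟩
    ∑ elements (λ z → ∑ (tuples m) λ ys → [ linked? _≤?_ (y ∷ z ∷ ys) ] weight (z ∷ ys))
      ≈⟨ ∑-cong elements (λ z → ∑-cong (tuples m) λ ys → trans
           ([]-⇔ (linked? _≤?_ (y ∷ z ∷ ys)) ((y ≤? z) ×-dec linked? _≤?_ (z ∷ ys))
             (λ { (y≤z ∷ l) → y≤z , l }) (λ (y≤z , l) → y≤z ∷ l))
           ([]-× (y ≤? z) (linked? _≤?_ (z ∷ ys)))) ⟩
    ∑ elements (λ z → ∑ (tuples m) λ ys → [ y ≤? z ] [ linked? _≤?_ (z ∷ ys) ] weight (z ∷ ys))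
      ≈⟨ sum-by-head (y ≤?_) m ⟩
    ∑ elements (λ z → [ y ≤? z ] ((x ↑ ρ z) * chainsAbove z m)) ∎

  A-suc : ∀ m → A (suc m) ≈ ∑ elements (λ z → (x ↑ ρ z) * chainsAbove z m)
  A-suc m = begin
    A (suc m)
      ≈⟨ ∑-filter (linked? _≤?_) (tuples (suc m)) weight ⟩
    ∑ (tuples (suc m)) (λ ys → [ linked? _≤?_ ys ] weight ys)
      ≈⟨ ∑-cartesianProductWith _∷_ elements (tuples m) _ ⟩
    ∑ elements (λ z → ∑ (tuples m) λ ys → [ yes tt ] [ linked? _≤?_ (z ∷ ys) ] weight (z ∷ ys))
      ≈⟨ sum-by-head (λ _ → yes tt) m ⟩
    ∑ elements (λ z → (x ↑ ρ z) * chainsAbove z m) ∎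

-- The numerator of the root poset

module RootChains {c ℓ} (R : CommutativeRing c ℓ) (x : CommutativeRing.Carrier R) (m : ℕ) where
  private h = m ℕ.+ m
  open CommutativeRing R hiding (rawRing)
  open ListSum R
  open PowerSeries R
  open Exp semiring using (^-homo-*) renaming (_^_ to _↑_)

  w : ℕ → Carrier
  w n = x ↑ (h ∸ n)

  open Chains R w h public
  open WeakChains R x (Φ⁺B (suc m)) rk public
  open Polynomial (CommutativeRing.rawRing R)
  open RawRing rawRing using () renaming (1# to 1ₚ)
  open Numerator (Φ⁺B (suc m)) rk using (maxRank)
  open SetoidReasoning setoid

  rk≡ : (α : PosRoot (suc m)) → rk α ≡ h ∸ (coordI α ℕ.+ coordC α)
  rk≡ α = ≡.trans (≡.sym (ℕ.m+n∸n≡m (rk α) (coordI α ℕ.+ coordC α))) (≡.cong (_∸ (coordI α ℕ.+ coordC α)) (rk-coords α))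

  -- Coordinates are a bijection onto the valid pairs: `root` supplies a root for each of them and
  -- `coords-injective` excludes a second one.
  sum-at-point : ∀ i j k →
    ∑ (posRoots (suc m)) (λ z → [ (coordI z ≟ i) ×-dec (coordC z ≟ j) ]
                                (w (coordI z ℕ.+ coordC z) * Y (suc (coordI z)) (suc (coordC z)) k))
      ≈ [ valid? i j ] (w (i ℕ.+ j) * Y (suc i) (suc j) k)
  sum-at-point i j k = go (valid? i j)
    where
    f : PosRoot (suc m) → Carrier
    f z = w (coordI z ℕ.+ coordC z) * Y (suc (coordI z)) (suc (coordC z)) k

    at? : ∀ z → Dec (coordI z ≡ i × coordC z ≡ j)
    at? z = (coordI z ≟ i) ×-dec (coordC z ≟ j)

    go : Dec (Valid i j) →
         ∑ (posRoots (suc m)) (λ z → [ at? z ] f z) ≈ [ valid? i j ] (w (i ℕ.+ j) * Y (suc i) (suc j) k)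
    go (no ¬v) = trans
      (∑-[]-none at? {posRoots (suc m)} f
        (All.tabulate λ { {α} _ (≡.refl , ≡.refl) → ¬v (coordI≤coordC α , coordI+coordC≤2m α) }))
      (sym ([]-false (valid? i j) ¬v))
    go (yes v@(i≤j , i+j≤h)) =
      let α , coordI≡i , coordC≡j = root {m} i≤j i+j≤h
      in trans
        (∑-[]-one at? f (posRoots-unique (suc m)) (posRoots-complete α) (coordI≡i , coordC≡j)
          (λ (p , q) → coords-injective (≡.trans p (≡.sym coordI≡i)) (≡.trans q (≡.sym coordC≡j))))
        (trans (reflexive (≡.cong₂ (λ i j → w (i ℕ.+ j) * Y (suc i) (suc j) k) coordI≡i coordC≡j))
               (sym ([]-true (valid? i j) v)))

  sum-below : ∀ i j k →
    ∑ (posRoots (suc m)) (λ z → [ coordI z <? i ] [ coordC z <? j ]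
                                (w (coordI z ℕ.+ coordC z) * Y (suc (coordI z)) (suc (coordC z)) k))
      ≈ Y i j (suc k)
  sum-below i j k = trans
    (∑-by-values coordI coordC (posRoots (suc m)) (λ z → w (coordI z ℕ.+ coordC z) * Y (suc (coordI z)) (suc (coordC z)) k) i j)
    (∑<-cong i λ i′ → ∑<-cong j λ j′ → sum-at-point i′ j′ k)

  -- Both sides sum over the next element of the chain, and the roots above α are those with both
  -- coordinates at most its own. `weighted` packages the induction hypothesis on the length.
  chainsAbove≈Y : ∀ k (α : PosRoot (suc m)) → chainsAbove α k ≈ Y (suc (coordI α)) (suc (coordC α)) k

  weighted : ∀ k (z : PosRoot (suc m)) →
    ((x ↑ rk z) * chainsAbove z k) ≈ (w (coordI z ℕ.+ coordC z) * Y (suc (coordI z)) (suc (coordC z)) k)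
  weighted k z = *-cong (reflexive (≡.cong (x ↑_) (rk≡ z))) (chainsAbove≈Y k z)

  chainsAbove≈Y zero    α = +-identityʳ 1#
  chainsAbove≈Y (suc k) α = begin
    chainsAbove α (suc k)
      ≈⟨ chainsAbove-suc α k ⟩
    ∑ (posRoots (suc m)) (λ z → [ α ≼? z ] ((x ↑ rk z) * chainsAbove z k))
      ≈⟨ ∑-cong (posRoots (suc m)) (λ z → trans ([]-cong (α ≼? z) (weighted k z))
           (trans ([]-⇔ (α ≼? z) ((coordI z <? suc (coordI α)) ×-dec (coordC z <? suc (coordC α)))
             (λ α≼z → let p , q = ≼⇒≤ {α = α} {z} α≼z in s≤s p , s≤s q)
             (λ { (s≤s p , s≤s q) → ≤⇒≼ {α = α} {z} p q }))
           ([]-× (coordI z <? suc (coordI α)) (coordC z <? suc (coordC α))))) ⟩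
    ∑ (posRoots (suc m)) (λ z → [ coordI z <? suc (coordI α) ] [ coordC z <? suc (coordC α) ]
                                (w (coordI z ℕ.+ coordC z) * Y (suc (coordI z)) (suc (coordC z)) k))
      ≈⟨ sum-below (suc (coordI α)) (suc (coordC α)) k ⟩
    Y (suc (coordI α)) (suc (coordC α)) (suc k) ∎

  -- The bounds `suc m` and `suc h` exceed all coordinates, so the whole poset is summed.
  A≈Y : ∀ k → A k ≈ Y (suc m) (suc h) k
  A≈Y zero    = +-identityʳ 1#
  A≈Y (suc k) = begin
    A (suc k)
      ≈⟨ A-suc k ⟩
    ∑ (posRoots (suc m)) (λ z → (x ↑ rk z) * chainsAbove z k)
      ≈⟨ ∑-cong (posRoots (suc m)) (λ z → trans (weighted k z) (sym (trans
           ([]-true (coordI z <? suc m) (toℕ<n (firstIndex z)))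
           ([]-true (coordC z <? suc h) (s≤s (ℕ.≤-trans (ℕ.m≤n+m _ (coordI z)) (coordI+coordC≤2m z))))))) ⟩
    ∑ (posRoots (suc m)) (λ z → [ coordI z <? suc m ] [ coordC z <? suc h ]
                                (w (coordI z ℕ.+ coordC z) * Y (suc (coordI z)) (suc (coordC z)) k))
      ≈⟨ sum-below (suc m) (suc h) k ⟩
    Y (suc m) (suc h) (suc k) ∎

  maxRank≡h : maxRank ≡ h
  maxRank≡h = ℕ.≤-antisym
    (max≤v⁺ {xs = map rk (posRoots (suc m))} z≤n (All.map⁺ (All.universal rk≤h (posRoots (suc m)))))
    (≡.subst (ℕ._≤ maxRank) rk-top (All.lookup (xs≤max 0 (map rk (posRoots (suc m)))) (∈-map⁺ rk (posRoots-complete top))))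
    where
    rk≤h : (α : PosRoot (suc m)) → rk α ℕ.≤ h
    rk≤h α = ℕ.≤-trans (ℕ.m≤m+n (rk α) _) (ℕ.≤-reflexive (rk-coords α))
    top-root : ∃ λ α → coordI {m} α ≡ 0 × coordC α ≡ 0
    top-root = root z≤n z≤n
    top : PosRoot (suc m)
    top = proj₁ top-root
    rk-top : rk top ≡ h
    rk-top = ≡.trans (rk≡ top) (≡.cong₂ (λ i j → h ∸ (i ℕ.+ j)) (proj₁ (proj₂ top-root)) (proj₂ (proj₂ top-root)))

  -- The denominator lists the ranks upwards from the outermost factor and `D` lists the coordinate
  -- sums downwards, so the factors agree one by one. The general `g` covers the tails of `upTo`.
  D-factors : ∀ a n (g : ℕ → ℕ) → (∀ i → g i ≡ a ℕ.+ i) → a ℕ.+ n ≡ suc h → ∀ f →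
    foldr (λ a → ∆ (x ↑ a)) f (applyUpTo g n) ≗ D n f
  D-factors a zero    g hg eq f k = refl
  D-factors a (suc n) g hg eq f k = trans
    (∆-cong (x ↑ g 0) (D-factors (suc a) n (g ∘ suc) (λ i → ≡.trans (hg (suc i)) (ℕ.+-suc a i)) (≡.trans (≡.sym (ℕ.+-suc a n)) eq) f) k)
    (reflexive (≡.cong (λ b → ∆ (x ↑ b) (D n f) k) g0≡))
    where
    g0≡ : g 0 ≡ h ∸ n
    g0≡ = ≡.trans (hg 0) (≡.trans (ℕ.+-identityʳ a) (≡.trans (≡.sym (ℕ.m+n∸n≡m a n))
      (≡.cong (_∸ n) (ℕ.suc-injective (≡.trans (≡.sym (ℕ.+-suc a n)) eq)))))

  -- The series `N m` cut off after t^m; by `N-vanishes` nothing is lost.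
  numerator : Poly
  numerator = applyUpTo (N m) (suc m)

  coeff-applyUpTo : ∀ (f : ℕ → Carrier) {n k} → k ℕ.< n → coeff (applyUpTo f n) k ≡ f k
  coeff-applyUpTo f {suc n} {zero}  _         = ≡.refl
  coeff-applyUpTo f {suc n} {suc k} (s≤s k<n) = coeff-applyUpTo (f ∘ suc) k<n

  coeff-applyUpTo-≥ : ∀ (f : ℕ → Carrier) {n k} → n ℕ.≤ k → coeff (applyUpTo f n) k ≡ 0#
  coeff-applyUpTo-≥ f {zero}          _         = ≡.refl
  coeff-applyUpTo-≥ f {suc n} {suc k} (s≤s n≤k) = coeff-applyUpTo-≥ (f ∘ suc) n≤k

  coeff-numerator : ∀ k → coeff numerator k ≈ N m k
  coeff-numerator k with k ℕ.≤? m
  ... | yes k≤m = reflexive (coeff-applyUpTo (N m) (s≤s k≤m))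
  ... | no k≰m  = trans (reflexive (coeff-applyUpTo-≥ (N m) (ℕ.≰⇒> k≰m)))
                           (sym (N-vanishes m m ≡.refl ℕ.≤-refl (ℕ.≰⇒> k≰m)))

  numerator-correct : ∀ k →
    coeff numerator k ≈ (A *ₛ coeff (foldr _*ₚ_ 1ₚ (map (λ a → 1- (x ↑ a) t) (upTo (suc maxRank))))) k
  numerator-correct k = sym (begin
    (A *ₛ coeff (foldr _*ₚ_ 1ₚ (map (λ a → 1- (x ↑ a) t) (upTo (suc maxRank))))) k
      ≈⟨ *ₛ-factors (x ↑_) (upTo (suc maxRank)) A k ⟩
    foldr (λ a → ∆ (x ↑ a)) A (upTo (suc maxRank)) k
      ≈⟨ reflexive (≡.cong (λ H → foldr (λ a → ∆ (x ↑ a)) A (upTo (suc H)) k) maxRank≡h) ⟩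
    foldr (λ a → ∆ (x ↑ a)) A (upTo (suc h)) k            ≈⟨ D-factors 0 (suc h) id (λ _ → ≡.refl) ≡.refl A k ⟩
    D (suc h) A k                                        ≈⟨ D-cong (suc h) A≈Y k ⟩
    N m k                                                ≈⟨ coeff-numerator k ⟨
    coeff numerator k ∎)

  -- The corner `(a , a)` has rank 2(m - a). With d = m - a the sum of the ranks telescopes through
  -- 2d + d(d - 1) = (d + 1)d.
  topWeight≈ : ∀ i d → i ℕ.+ d ≡ m → (topWeight i * (x ↑ (d ℕ.* (d ∸ 1)))) ≈ (x ↑ (m ℕ.* (m ∸ 1)))
  topWeight≈ zero    d ≡.refl = *-identityˡ _
  topWeight≈ (suc i) d eq = begin
    (w (suc (i ℕ.+ suc i)) * topWeight i) * (x ↑ (d ℕ.* (d ∸ 1)))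
      ≈⟨ *-congʳ (*-comm _ _) ⟩
    (topWeight i * w (suc (i ℕ.+ suc i))) * (x ↑ (d ℕ.* (d ∸ 1)))
      ≈⟨ *-assoc _ _ _ ⟩
    topWeight i * (w (suc (i ℕ.+ suc i)) * (x ↑ (d ℕ.* (d ∸ 1))))
      ≈⟨ *-congˡ (^-homo-* x (h ∸ suc (i ℕ.+ suc i)) (d ℕ.* (d ∸ 1))) ⟨
    topWeight i * (x ↑ (h ∸ suc (i ℕ.+ suc i) ℕ.+ d ℕ.* (d ∸ 1)))
      ≈⟨ *-congˡ (reflexive (≡.cong (x ↑_) (≡.trans (≡.cong (ℕ._+ d ℕ.* (d ∸ 1)) exponent) (square d)))) ⟩
    topWeight i * (x ↑ (suc d ℕ.* d))
      ≈⟨ topWeight≈ i (suc d) (≡.trans (ℕ.+-suc i d) eq) ⟩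
    x ↑ (m ℕ.* (m ∸ 1)) ∎
    where
    regroup : ∀ i d → suc i ℕ.+ d ℕ.+ (suc i ℕ.+ d) ≡ d ℕ.+ d ℕ.+ suc (i ℕ.+ suc i)
    regroup = ℕ-Solver.solve-∀
    exponent : h ∸ suc (i ℕ.+ suc i) ≡ d ℕ.+ d
    exponent = ≡.trans (≡.cong (_∸ suc (i ℕ.+ suc i)) (≡.trans (≡.cong₂ ℕ._+_ (≡.sym eq) (≡.sym eq)) (regroup i d)))
      (ℕ.m+n∸n≡m (d ℕ.+ d) (suc (i ℕ.+ suc i)))
    square : ∀ d → d ℕ.+ d ℕ.+ d ℕ.* (d ∸ 1) ≡ suc d ℕ.* d
    square zero    = ≡.refl
    square (suc e) = identity e
      where
      identity : ∀ e → suc e ℕ.+ suc e ℕ.+ suc e ℕ.* e ≡ suc (suc e) ℕ.* suc e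
      identity = ℕ-Solver.solve-∀

  numerator-top : coeff numerator m ≈ (x ↑ (m ℕ.* (m ∸ 1)))
  numerator-top = trans (coeff-numerator m) (trans (N-top m ≡.refl)
    (trans (sym (*-identityʳ _)) (topWeight≈ m 0 (ℕ.+-identityʳ m))))

  module Evaluation
    (φ : Carrier → ℤ)
    (φ-hom : SemiringMorphisms.IsSemiringHomomorphism (Semiring.rawSemiring semiring) ℤ.+-*-rawSemiring φ)
    (φ-x : φ x ≡ 1ℤ)
    where
    open SemiringMorphisms.IsSemiringHomomorphism φ-hom using (⟦⟧-cong; +-homo; *-homo; 0#-homo; 1#-homo)

    φ-x^ : ∀ n → φ (x ↑ n) ≡ 1ℤ
    φ-x^ zero    = 1#-homo
    φ-x^ (suc n) = ≡.trans (*-homo x (x ↑ n)) (≡.cong₂ ℤ._*_ φ-x (φ-x^ n))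

    open Specialisation R w h φ φ-hom (λ n → φ-x^ (h ∸ n)) using (φ-N)

    φ-numerator : ∀ k → φ (N m k) ≡ + ((m C k) ℕ.* (m C k))
    φ-numerator k = ≡.trans (φ-N m m ≡.refl ℕ.≤-refl k)
      (≡.trans (≡.cong₂ ℤ._*_ (binom-C m k) (binom-C m k)) (≡.sym (ℤ.pos-* (m C k) (m C k))))

    φ-eval-1 : ∀ (f : ℕ → Carrier) (g : ℕ → ℕ) → (∀ k → φ (f k) ≡ + g k) →
               ∀ n → φ (eval (applyUpTo f n) 1#) ≡ + sumℕ (applyUpTo g n)
    φ-eval-1 f g h zero    = 0#-homo
    φ-eval-1 f g h (suc n) = ≡.trans (+-homo (f 0) _) (≡.cong₂ ℤ._+_ (h 0)
      (≡.trans (⟦⟧-cong (*-identityˡ _)) (φ-eval-1 (f ∘ suc) (g ∘ suc) (h ∘ suc) n)))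

    φ-total : φ (eval numerator 1#) ≡ + (h C m)
    φ-total = ≡.trans (φ-eval-1 (N m) (λ k → (m C k) ℕ.* (m C (k ℕ.+ 0)))
        (λ k → ≡.trans (φ-numerator k) (≡.cong (λ j → + ((m C k) ℕ.* (m C j))) (≡.sym (ℕ.+-identityʳ k)))) (suc m))
      (≡.cong +_ (≡.trans (vandermonde m m 0) (≡.cong (h C_) (ℕ.+-identityʳ m))))

-- Evaluation at q = 1 and the theorem over ℤ[q]

eval-at-1-isHomomorphism :
  SemiringMorphisms.IsSemiringHomomorphism (RawRing.rawSemiring ℤ[q].rawRing) ℤ.+-*-rawSemiring (λ p → ℤ[q].eval p 1ℤ)
eval-at-1-isHomomorphism = record
  { isNearSemiringHomomorphism = record
    { +-isMonoidHomomorphism = record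
      { isMagmaHomomorphism = record
        { isRelHomomorphism = record { cong = λ {p} {s} h → eval-cong {p} {s} (coeffwise h) 1ℤ }
        ; homo = λ p s → eval-+ p s 1ℤ
        }
      ; ε-homo = ≡.refl
      }
    ; *-homo = λ p s → eval-* p s 1ℤ
    }
  ; 1#-homo = ≡.refl
  }
  where open PolynomialRing ℤ.+-*-commutativeRing

open import Data.Nat.Base using (_≤_; _*_; _^_)

corollary8p3 : (r : ℕ) → 1 ≤ r →
    Σ[ N ∈ ℤ[q][t].Poly ]
    IsNumerator (Φ⁺B r) rk N
    × ℤ[q].eval (ℤ[q][t].eval N (RawRing.1# ℤ[q].rawRing)) 1ℤ ≡ + ((2 * r ∸ 2) C (r ∸ 1))
    × ℤ[q][t].HasDegree N (r ∸ 1)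
    × RawRing._≈_ ℤ[q].rawRing (ℤ[q][t].coeff N (r ∸ 1)) (q^ ((r ∸ 1) * (r ∸ 2)))
    × (∀ k → k ≤ r ∸ 1 → ℤ[t].coeff (q≔1 N) k ≡ + (((r ∸ 1) C k) ^ 2))
corollary8p3 (suc m) _ =
  numerator , numerator-correct , total , (leading≉0 , λ n m<n → Rq.reflexive (coeff-applyUpTo-≥ (N m) m<n)) ,
  numerator-top , at-1
  where
  ℤ[q]-ring : CommutativeRing _ _
  ℤ[q]-ring = PolynomialRing.commutativeRing ℤ.+-*-commutativeRing
  module Rq = CommutativeRing ℤ[q]-ring
  open RootChains ℤ[q]-ring ℤ[q].X m
  open Evaluation (λ p → ℤ[q].eval p 1ℤ) eval-at-1-isHomomorphism ≡.refl

  total : ℤ[q].eval (ℤ[q][t].eval numerator (RawRing.1# ℤ[q].rawRing)) 1ℤ ≡ + ((2 * suc m ∸ 2) C m)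
  total = ≡.trans φ-total (≡.cong (λ n → + (n C m)) (≡.sym
    (≡.trans (≡.cong (λ n → m ℕ.+ suc n ∸ 1) (ℕ.+-identityʳ m)) (≡.cong (_∸ 1) (ℕ.+-suc m m)))))

  coeff-q≔1 : ∀ (p : ℤ[q][t].Poly) k → ℤ[t].coeff (q≔1 p) k ≡ ℤ[q].eval (ℤ[q][t].coeff p k) 1ℤ
  coeff-q≔1 []      k       = ≡.refl
  coeff-q≔1 (a ∷ p) zero    = ≡.refl
  coeff-q≔1 (a ∷ p) (suc k) = coeff-q≔1 p k

  eval-coeff : ∀ k → k ≤ m → ℤ[q].eval (ℤ[q][t].coeff numerator k) 1ℤ ≡ + ((m C k) * (m C k))
  eval-coeff k k≤m = ≡.trans (≡.cong (λ p → ℤ[q].eval p 1ℤ) (coeff-applyUpTo (N m) (s≤s k≤m))) (φ-numerator k)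

  at-1 : ∀ k → k ≤ m → ℤ[t].coeff (q≔1 numerator) k ≡ + ((m C k) ^ 2)
  at-1 k k≤m = ≡.trans (coeff-q≔1 numerator k) (≡.trans (eval-coeff k k≤m)
    (≡.cong (λ n → + ((m C k) * n)) (≡.sym (ℕ.*-identityʳ (m C k)))))

  -- Evaluation at q = 1 sends this coefficient to the square of `m C m`, that is 1, and the zero
  -- polynomial to 0.
  leading≉0 : ¬ (ℤ[q][t].coeff numerator m Rq.≈ Rq.0#)
  leading≉0 ≈0 with ≡.trans (≡.sym (≡.trans (eval-coeff m ℕ.≤-refl) (≡.cong (λ n → + (n * n)) (nCn≡1 m))))
                            (PolynomialRing.eval-cong ℤ.+-*-commutativeRing {ℤ[q][t].coeff numerator m} {[]}
                              (PolynomialRing.coeffwise ≈0) 1ℤ)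
  ... | ()
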